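{- Let $\Gamma$ be a finite, simple, strongly connected digraph of order $n\geq 4$ which is not an undirected graph. Then $\dim(\Gamma)=n-2$ if and only if $\Gamma$ is isomorphic to one of $G_2[K_1,P_2,K_1]$, $G_1[K_1,K_t,K_{n-t-1}]$, $G_2[K_1,K_t,K_{n-t-1}]$, $G_2[K_t,K_{n-t-1},K_1]$, or $G_2[K_1,\overline{K}_{n-2},K_1]$ for some integer $t$ with $1\leq t\leq n-2$.
   Context: All digraphs are finite, simple (no loops, at most one arc from $x$ to $y$ for each ordered pair) and strongly connected. $\partial(x,y)$ is the length of a shortest directed path from $x$ to $y$; $\tilde\partial(x,y)=(\partial(x,y),\partial(y,x))$. A subset $\{w_1,\dots,w_m\}$ of $V(\Gamma)$ is a weakly resolving set if $(\tilde\partial(w_1,u),\dots,\tilde\partial(w_m,u))\neq(\tilde\partial(w_1,v),\dots,\tilde\partial(w_m,v))$ for all distinct vertices $u,v$; $\dim(\Gamma)$ (weak metric dimension) is the minimum size of a weakly resolving set. A digraph is an undirected graph if for every arc $(x,y)$, $(y,x)$ is also an arc. $K_t$ is the complete digraph on $t$ vertices (all ordered pairs of distinct vertices are arcs), $\overline{K}_t$ the digraph on $t$ vertices with no arcs, and $P_2$ the digraph on two vertices $a,b$ with the single arc $(a,b)$. $G_1$ is the digraph on $\{0,1,2\}$ with arcs $(0,1),(1,2),(2,1),(2,0)$; $G_2$ is the digraph on $\{0,1,2\}$ with arcs $(0,1),(1,0),(1,2),(2,1),(2,0)$. For a digraph $G$ on $\{0,1,\dots,m-1\}$ and digraphs $H_0,\dots,H_{m-1}$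 with disjoint vertex sets, the generalized lexicographic product $G[H_0,\dots,H_{m-1}]$ has vertex set $V(H_0)\cup\dots\cup V(H_{m-1})$, and for $x\in V(H_i)$, $y\in V(H_j)$ there is an arc $(x,y)$ iff either $i=j$ and $(x,y)$ is an arc of $H_i$, or $i\neq j$ and $(i,j)$ is an arc of $G$. -}

module Defs where

open import Data.Nat using (ℕ; zero; suc; _≤_; _∸_)
open import Data.Bool using (Bool; true; false; not)
open import Data.Fin using (Fin; zero; suc; _≟_)
open import Data.Fin.Subset using (Subset; _∈_; ∣_∣)
open import Data.Product using (Σ; ∃; ∃-syntax; _×_; _,_)
open import Data.Sum using (_⊎_)
open import Function.Bundles using (_↔_; Inverse)
open import Relation.Nullary using (¬_; yes; no)
open import Relation.Nullary.Decidable using (⌊_⌋)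
open import Relation.Binary.PropositionalEquality using (_≡_; _≢_; refl)

-- A digraph on vertex type V: arc x y ≡ true iff (x , y) is an arc.
-- (Simplicity "at most one arc x→y" is built in.)
Digraph : Set → Set
Digraph V = V → V → Bool

Loopless : {V : Set} → Digraph V → Set
Loopless {V} A = ∀ (x : V) → A x x ≡ false

data Walk {V : Set} (A : Digraph V) : V → V → ℕ → Set where
  nil  : ∀ {x} → Walk A x x 0
  cons : ∀ {x y z k} → A x y ≡ true → Walk A y z k → Walk A x z (suc k)

StronglyConnected : {V : Set} → Digraph V → Set
StronglyConnected {V} A = ∀ (x y : V) → ∃[ k ] Walk A x y k

Undirected : {V : Set} → Digraph V → Set
Undirected {V} A = ∀ (x y : V) → A x y ≡ true → A y x ≡ true

IsDist : {V : Set} → Digraph V → V → V → ℕ → Set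
IsDist A x y d = Walk A x y d × (∀ m → Data.Nat._<_ m d → ¬ Walk A x y m)

Distinguishes : {V : Set} → Digraph V → V → V → V → Set
Distinguishes A w u v =
  ∃[ d₁ ] ∃[ d₂ ] ∃[ e₁ ] ∃[ e₂ ]
    (IsDist A w u d₁ × IsDist A w v d₂ × IsDist A u w e₁ × IsDist A v w e₂
     × ((d₁ , e₁) ≢ (d₂ , e₂)))

WeaklyResolving : {n : ℕ} → Digraph (Fin n) → Subset n → Set
WeaklyResolving {n} A W =
  ∀ (u v : Fin n) → u ≢ v → ∃[ w ] (w ∈ W × Distinguishes A w u v)

HasDim : {n : ℕ} → Digraph (Fin n) → ℕ → Set
HasDim {n} A k =
  (∃[ W ] (WeaklyResolving A W × ∣ W ∣ ≡ k))
  × (∀ (W : Subset n) → WeaklyResolving A W → k ≤ ∣ W ∣)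

Iso : {V U : Set} → Digraph V → Digraph U → Set
Iso {V} {U} A B = Σ (V ↔ U) λ f → ∀ (x y : V) → A x y ≡ B (Inverse.to f x) (Inverse.to f y)

K : (t : ℕ) → Digraph (Fin t)
K t x y = not ⌊ x ≟ y ⌋

Kbar : (t : ℕ) → Digraph (Fin t)
Kbar t x y = false

P2 : Digraph (Fin 2)
P2 zero (suc zero) = true
P2 _ _ = false

G1 : Digraph (Fin 3)
G1 zero (suc zero) = true
G1 (suc zero) (suc (suc zero)) = true
G1 (suc (suc zero)) (suc zero) = true
G1 (suc (suc zero)) zero = true
G1 _ _ = false

G2 : Digraph (Fin 3)
G2 zero (suc zero) = true
G2 (suc zero) zero = true
G2 (suc zero) (suc (suc zero)) = true
G2 (suc (suc zero)) (suc zero) = true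
G2 (suc (suc zero)) zero = true
G2 _ _ = false

Lex : {m : ℕ} (G : Digraph (Fin m)) (s : Fin m → ℕ) (H : (i : Fin m) → Digraph (Fin (s i)))
    → Digraph (Σ (Fin m) λ i → Fin (s i))
Lex G s H (i , x) (j , y) with i ≟ j
... | yes refl = H i x y
... | no _ = G i j

size3 : ℕ → ℕ → ℕ → Fin 3 → ℕ
size3 a b c zero = a
size3 a b c (suc zero) = b
size3 a b c (suc (suc zero)) = c

comp3 : {a b c : ℕ} → Digraph (Fin a) → Digraph (Fin b) → Digraph (Fin c)
      → (i : Fin 3) → Digraph (Fin (size3 a b c i))
comp3 H₀ H₁ H₂ zero = H₀
comp3 H₀ H₁ H₂ (suc zero) = H₁
comp3 H₀ H₁ H₂ (suc (suc zero)) = H₂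

Lex3 : (G : Digraph (Fin 3)) {a b c : ℕ} → Digraph (Fin a) → Digraph (Fin b) → Digraph (Fin c)
     → Digraph (Σ (Fin 3) λ i → Fin (size3 a b c i))
Lex3 G {a} {b} {c} H₀ H₁ H₂ = Lex G (size3 a b c) (comp3 H₀ H₁ H₂)

Extremal : (n : ℕ) → Digraph (Fin n) → Set
Extremal n A =
  Iso A (Lex3 G2 (K 1) P2 (K 1))
  ⊎ (∃[ t ] (1 ≤ t × t ≤ n ∸ 2 ×
       (Iso A (Lex3 G1 (K 1) (K t) (K (n ∸ t ∸ 1)))
        ⊎ Iso A (Lex3 G2 (K 1) (K t) (K (n ∸ t ∸ 1)))
        ⊎ Iso A (Lex3 G2 (K t) (K (n ∸ t ∸ 1)) (K 1)))))
  ⊎ Iso A (Lex3 G2 (K 1) (Kbar (n ∸ 2)) (K 1))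

{-# OPTIONS --safe #-}
module Submission where

-- No set of n − 3 vertices is resolving iff every three vertices contain two that no vertex
-- outside the three tells apart.  Applied to the first three vertices of a geodesic this bounds
-- the diameter by 2, so distances are determined by arcs and the condition becomes one about the
-- types (w → v , v → w): every vertex w sees at most two types, and if it sees two, then
-- vertices of the same type are twins up to one vertex of the other type.
-- Suppose w has two out-only neighbours.  By the diameter bound the other type at w contains an
-- in-arc, and the twin conditions force all vertices other than w to be mutually adjacent: this
-- gives G₁[K₁,K,K] or G₂[K,K,K₁], and G₁[K₁,K,K] or G₂[K₁,K,K] for the reversed digraph.  If no
-- vertex has two out-only or two in-only neighbours, the ends of a one-way arc are joined in both
-- directions to all other vertices, and these are mutual twins, so they induce K or K̄, or P₂
-- when there are only two of them.
-- Conversely all five families are blow-ups of digraphs on at most four colours, for which the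
-- twin condition and the diameter bound are finite checks on the colours.

open import Defs
open import Data.Bool using (Bool; true; false; if_then_else_)
import Data.Bool.Properties as Bool
open import Data.Fin using (Fin; zero; suc; _≟_; fromℕ<)
open import Data.Fin.Patterns using (0F; 1F; 2F; 3F)
open import Data.Fin.Permutation using (Permutation; _⟨$⟩ʳ_; id; ↔⇒≡; cast-id; transpose; _∘ₚ_)
open import Data.Fin.Properties using (any?; all?; +↔⊎; 1↔⊤)
open import Data.Fin.Subset using (Subset; _∈_; _∉_; ∣_∣; _∪_; ⁅_⁆; ∁; ⊤; ⊥; inside; outside)
import Data.Fin.Subset.Properties as Subset
open import Data.Nat using (ℕ; zero; suc; _+_; _≤_; _<_; _∸_; z≤n; s≤s; _≡ᵇ_; +-0-rawMonoid)
open import Algebra.Definitions.RawMonoid +-0-rawMonoid using (sum)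
open import Data.Nat.Induction using (<-wellFounded)
import Data.Nat.Properties as ℕ
open import Data.Product using (Σ; ∃; ∃-syntax; _×_; _,_; proj₁; proj₂; swap)
open import Data.Product.Function.Dependent.Propositional using (Σ-↔)
open import Data.Product.Properties using (≡-dec)
open import Data.Sum using (_⊎_; inj₁; inj₂; [_,_]′)
  renaming (map to ⊎-map; map₁ to ⊎-map₁; map₂ to ⊎-map₂)
open import Data.Sum.Algebra using (⊎-cong)
open import Data.Unit using (tt) renaming (⊤ to Unit)
open import Data.Vec using (_∷_; lookup; here; there)
open import Function using (_∘_; flip)
open import Function.Bundles using (_⇔_; _↔_; Equivalence; Injection; Inverse; mk⇔; mk↔ₛ′)
open import Function.Construct.Composition using (_⇔-∘_; _↔-∘_)
open import Function.Construct.Identity using (↔-id)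
open import Function.Construct.Symmetry using (↔-sym)
open import Function.Properties.Inverse using (↔⇒↣)
open import Function.Related.Propositional using (module EquationalReasoning)
open import Induction.WellFounded using (Acc; acc)
open import Relation.Binary.Definitions using (DecidableEquality; tri<; tri≈; tri>)
open import Relation.Binary.PropositionalEquality
  using (_≡_; _≢_; refl; sym; trans; cong; cong₂; subst; ≢-sym; module ≡-Reasoning)
open import Relation.Nullary using (¬_; Dec; yes; no; does; contradiction)
open import Relation.Nullary.Decidable
  using (True; map′; _×-dec_; _⊎-dec_; _→-dec_; ¬?; toWitness; from-yes; decidable-stable)
open import Relation.Unary using (Decidable)

private
  variable
    m n : ℕ
    T T′ U V : Set

-- Twins

module _ (f : V → V → T) where

  TwinsUpTo : V → V → V → Set
  TwinsUpTo z x y = ∀ w → w ≢ x → w ≢ y → w ≢ z → f w x ≡ f w y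

  TwinPair : V → V → V → Set
  TwinPair x y z = TwinsUpTo z x y ⊎ TwinsUpTo y x z ⊎ TwinsUpTo x y z

  TwinTriples : Set
  TwinTriples = ∀ x y z → x ≢ y → x ≢ z → y ≢ z → TwinPair x y z

twinTriples-resp : {f : V → V → T} {g : V → V → T′} →
  (∀ {w x y} → w ≢ x → w ≢ y → f w x ≡ f w y → g w x ≡ g w y) → TwinTriples f → TwinTriples g
twinTriples-resp {f = f} {g} resp triples x y z x≢y x≢z y≢z =
  ⊎-map twins (⊎-map twins twins) (triples x y z x≢y x≢z y≢z)
  where
  twins : ∀ {x y z} → TwinsUpTo f z x y → TwinsUpTo g z x y
  twins t w w≢x w≢y w≢z = resp w≢x w≢y (t w w≢x w≢y w≢z)

module _ {f : V → V → T} (triples : TwinTriples f) where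

  no-three-values : ∀ {w x y z r s t} → w ≢ x → w ≢ y → w ≢ z →
    f w x ≡ r → f w y ≡ s → f w z ≡ t → r ≢ s → r ≢ t → ¬ s ≢ t
  no-three-values {w} {x} {y} {z} w≢x w≢y w≢z refl refl refl r≢s r≢t s≢t
    with triples x y z (r≢s ∘ cong (f w)) (r≢t ∘ cong (f w)) (s≢t ∘ cong (f w))
  ... | inj₁ x~y        = r≢s (x~y w w≢x w≢y w≢z)
  ... | inj₂ (inj₁ x~z) = r≢t (x~z w w≢x w≢z w≢y)
  ... | inj₂ (inj₂ y~z) = s≢t (y~z w w≢y w≢z w≢x)

  at-most-two-values : DecidableEquality T → ∀ {w x y r s} → w ≢ x → w ≢ y →
    f w x ≡ r → f w y ≡ s → r ≢ s → ∀ z → w ≢ z → f w z ≡ r ⊎ f w z ≡ s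
  at-most-two-values _≟ᵀ_ {w} {r = r} {s} w≢x w≢y wx wy r≢s z w≢z with f w z ≟ᵀ r | f w z ≟ᵀ s
  ... | yes wz≡r | _        = inj₁ wz≡r
  ... | no _     | yes wz≡s = inj₂ wz≡s
  ... | no wz≢r  | no wz≢s  =
    contradiction (≢-sym wz≢s) (no-three-values w≢x w≢y w≢z wx wy refl r≢s (≢-sym wz≢r))

  odd-one-out⇒twins : DecidableEquality V → ∀ {w x y z r s t} → w ≢ x → w ≢ y → w ≢ z →
    f w x ≡ r → f w y ≡ s → f w z ≡ t → r ≢ t → s ≢ t → TwinsUpTo f z x y
  odd-one-out⇒twins _≟ⱽ_ {w} {x} {y} {z} w≢x w≢y w≢z refl refl refl r≢t s≢t with x ≟ⱽ y
  ... | yes refl = λ _ _ _ _ → refl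
  ... | no x≢y with triples x y z x≢y (r≢t ∘ cong (f w)) (s≢t ∘ cong (f w))
  ... | inj₁ x~y        = x~y
  ... | inj₂ (inj₁ x~z) = contradiction (x~z w w≢x w≢z w≢y) r≢t
  ... | inj₂ (inj₂ y~z) = contradiction (y~z w w≢y w≢z w≢x) s≢t

-- Finite subsets

∣q∣<∣p∣⇒∃∈p∉q : (p q : Subset n) → ∣ q ∣ < ∣ p ∣ → ∃[ x ] (x ∈ p × x ∉ q)
∣q∣<∣p∣⇒∃∈p∉q p q q<p with any? (λ x → (x Subset.∈? p) ×-dec ¬? (x Subset.∈? q))
... | yes found = found
... | no none = contradiction
  (Subset.p⊆q⇒∣p∣≤∣q∣ λ {x} x∈p → decidable-stable (x Subset.∈? q) λ x∉q → none (x , x∈p , x∉q))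
  (ℕ.<⇒≱ q<p)

∣⁅x⁆∪p∣≤1+∣p∣ : (x : Fin n) (p : Subset n) → ∣ ⁅ x ⁆ ∪ p ∣ ≤ suc ∣ p ∣
∣⁅x⁆∪p∣≤1+∣p∣ zero    (b ∷ p)       =
  s≤s (subst (λ q → ∣ q ∣ ≤ ∣ b ∷ p ∣) (sym (Subset.∪-identityˡ p)) (Subset.∣p∣≤∣x∷p∣ b p))
∣⁅x⁆∪p∣≤1+∣p∣ (suc x) (inside ∷ p)  = s≤s (∣⁅x⁆∪p∣≤1+∣p∣ x p)
∣⁅x⁆∪p∣≤1+∣p∣ (suc x) (outside ∷ p) = ∣⁅x⁆∪p∣≤1+∣p∣ x p

x∉p⇒∣p∣<∣⁅x⁆∪p∣ : {x : Fin n} {p : Subset n} → x ∉ p → ∣ p ∣ < ∣ ⁅ x ⁆ ∪ p ∣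
x∉p⇒∣p∣<∣⁅x⁆∪p∣ {x = x} {p} x∉p = Subset.p⊂q⇒∣p∣<∣q∣
  (Subset.q⊆p∪q ⁅ x ⁆ p , x , Subset.p⊆p∪q p (Subset.x∈⁅x⁆ x) , x∉p)

pair : Fin n → Fin n → Subset n
pair x y = ⁅ x ⁆ ∪ ⁅ y ⁆

triple : Fin n → Fin n → Fin n → Subset n
triple x y z = ⁅ x ⁆ ∪ pair y z

∈⁅x⁆∪p⁻ : {u x : Fin n} {p : Subset n} → u ∈ ⁅ x ⁆ ∪ p → u ≡ x ⊎ u ∈ p
∈⁅x⁆∪p⁻ {x = x} {p} u∈ = ⊎-map₁ (Subset.x∈⁅y⁆⇒x≡y x) (Subset.x∈p∪q⁻ ⁅ x ⁆ p u∈)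

∉⁅x⁆∪p⁻ : {u x : Fin n} {p : Subset n} → u ∉ ⁅ x ⁆ ∪ p → u ≢ x × u ∉ p
∉⁅x⁆∪p⁻ {x = x} {p} u∉ =
  Subset.x∉⁅y⁆⇒x≢y (u∉ ∘ Subset.p⊆p∪q p) , u∉ ∘ Subset.q⊆p∪q ⁅ x ⁆ p

∈-pair⁻ : {u x y : Fin n} → u ∈ pair x y → u ≡ x ⊎ u ≡ y
∈-pair⁻ {y = y} u∈ = ⊎-map₂ (Subset.x∈⁅y⁆⇒x≡y y) (∈⁅x⁆∪p⁻ u∈)

∉-pair⁻ : {u x y : Fin n} → u ∉ pair x y → u ≢ x × u ≢ y
∉-pair⁻ u∉ with ∉⁅x⁆∪p⁻ u∉
... | u≢x , u∉y = u≢x , Subset.x∉⁅y⁆⇒x≢y u∉y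

∈-triple⁻ : {u x y z : Fin n} → u ∈ triple x y z → u ≡ x ⊎ u ≡ y ⊎ u ≡ z
∈-triple⁻ u∈ = ⊎-map₂ ∈-pair⁻ (∈⁅x⁆∪p⁻ u∈)

∉-triple⁻ : {u x y z : Fin n} → u ∉ triple x y z → u ≢ x × u ≢ y × u ≢ z
∉-triple⁻ u∉ with ∉⁅x⁆∪p⁻ u∉
... | u≢x , u∉yz = u≢x , ∉-pair⁻ u∉yz

∣pair∣≤2 : (x y : Fin n) → ∣ pair x y ∣ ≤ 2
∣pair∣≤2 x y = subst (λ k → ∣ pair x y ∣ ≤ suc k) (Subset.∣⁅x⁆∣≡1 y) (∣⁅x⁆∪p∣≤1+∣p∣ x ⁅ y ⁆)

∣triple∣≤3 : (x y z : Fin n) → ∣ triple x y z ∣ ≤ 3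
∣triple∣≤3 x y z = ℕ.≤-trans (∣⁅x⁆∪p∣≤1+∣p∣ x (pair y z)) (s≤s (∣pair∣≤2 y z))

2≤∣pair∣ : {x y : Fin n} → x ≢ y → 2 ≤ ∣ pair x y ∣
2≤∣pair∣ {x = x} {y} x≢y =
  subst (_< ∣ pair x y ∣) (Subset.∣⁅x⁆∣≡1 y) (x∉p⇒∣p∣<∣⁅x⁆∪p∣ (Subset.x≢y⇒x∉⁅y⁆ x≢y))

3≤∣triple∣ : {x y z : Fin n} → x ≢ y → x ≢ z → y ≢ z → 3 ≤ ∣ triple x y z ∣
3≤∣triple∣ x≢y x≢z y≢z =
  ℕ.≤-<-trans (2≤∣pair∣ y≢z) (x∉p⇒∣p∣<∣⁅x⁆∪p∣ ([ x≢y , x≢z ]′ ∘ ∈-pair⁻))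

three-elements : {p : Subset n} → 2 < ∣ p ∣ →
  ∃[ x ] ∃[ y ] ∃[ z ] (x ∈ p × y ∈ p × z ∈ p × x ≢ y × x ≢ z × y ≢ z)
three-elements {n} {p} 2<p
  with ∣q∣<∣p∣⇒∃∈p∉q p ⊥ (subst (_< ∣ p ∣) (sym (Subset.∣⊥∣≡0 n)) (ℕ.≤-<-trans z≤n 2<p))
... | z , z∈p , _
  with ∣q∣<∣p∣⇒∃∈p∉q p ⁅ z ⁆ (subst (_< ∣ p ∣) (sym (Subset.∣⁅x⁆∣≡1 z)) (ℕ.<-trans (ℕ.n<1+n 1) 2<p))
... | y , y∈p , y∉z with ∣q∣<∣p∣⇒∃∈p∉q p (pair y z) (ℕ.≤-<-trans (∣pair∣≤2 y z) 2<p)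
... | x , x∈p , x∉yz with ∉-pair⁻ x∉yz
... | x≢y , x≢z = x , y , z , x∈p , y∈p , z∈p , x≢y , x≢z , Subset.x∉⁅y⁆⇒x≢y y∉z

fourth-vertex : 3 < n → (x y z : Fin n) → ∃[ u ] (u ≢ x × u ≢ y × u ≢ z)
fourth-vertex {n} 3<n x y z
  with ∣q∣<∣p∣⇒∃∈p∉q ⊤ (triple x y z)
         (ℕ.≤-<-trans (∣triple∣≤3 x y z) (subst (3 <_) (sym (Subset.∣⊤∣≡n n)) 3<n))
... | u , _ , u∉ = u , ∉-triple⁻ u∉

ContainsTwins : (Fin n → Fin n → T) → Subset n → Set
ContainsTwins f p = ∃[ u ] ∃[ v ] (u ∈ p × v ∈ p × u ≢ v × (∀ w → w ∉ p → f w u ≡ f w v))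

twinTriples⇔ : {f : Fin n → Fin n → T} → (∀ p → 2 < ∣ p ∣ → ContainsTwins f p) ⇔ TwinTriples f
twinTriples⇔ {f = f} = mk⇔ twins⇒triples triples⇒twins
  where
  twins⇒triples : (∀ p → 2 < ∣ p ∣ → ContainsTwins f p) → TwinTriples f
  twins⇒triples twins x y z x≢y x≢z y≢z with twins (triple x y z) (3≤∣triple∣ x≢y x≢z y≢z)
  ... | u , v , u∈ , v∈ , u≢v , agree = split (∈-triple⁻ u∈) (∈-triple⁻ v∈)
    where
    alike : ∀ {w} → w ≢ x → w ≢ y → w ≢ z → f w u ≡ f w v
    alike w≢x w≢y w≢z = agree _ ([ w≢x , [ w≢y , w≢z ]′ ]′ ∘ ∈-triple⁻)

    split : u ≡ x ⊎ u ≡ y ⊎ u ≡ z → v ≡ x ⊎ v ≡ y ⊎ v ≡ z → TwinPair f x y z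
    split (inj₁ refl)        (inj₁ refl)        = contradiction refl u≢v
    split (inj₁ refl)        (inj₂ (inj₁ refl)) = inj₁ λ _ w≢x w≢y w≢z → alike w≢x w≢y w≢z
    split (inj₁ refl)        (inj₂ (inj₂ refl)) = inj₂ (inj₁ λ _ w≢x w≢z w≢y → alike w≢x w≢y w≢z)
    split (inj₂ (inj₁ refl)) (inj₁ refl)        = inj₁ λ _ w≢x w≢y w≢z → sym (alike w≢x w≢y w≢z)
    split (inj₂ (inj₁ refl)) (inj₂ (inj₁ refl)) = contradiction refl u≢v
    split (inj₂ (inj₁ refl)) (inj₂ (inj₂ refl)) = inj₂ (inj₂ λ _ w≢y w≢z w≢x → alike w≢x w≢y w≢z)
    split (inj₂ (inj₂ refl)) (inj₁ refl)        =
      inj₂ (inj₁ λ _ w≢x w≢z w≢y → sym (alike w≢x w≢y w≢z))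
    split (inj₂ (inj₂ refl)) (inj₂ (inj₁ refl)) =
      inj₂ (inj₂ λ _ w≢y w≢z w≢x → sym (alike w≢x w≢y w≢z))
    split (inj₂ (inj₂ refl)) (inj₂ (inj₂ refl)) = contradiction refl u≢v

  triples⇒twins : TwinTriples f → ∀ p → 2 < ∣ p ∣ → ContainsTwins f p
  triples⇒twins triples p 2<p with three-elements 2<p
  ... | x , y , z , x∈p , y∈p , z∈p , x≢y , x≢z , y≢z = locate (triples x y z x≢y x≢z y≢z)
    where
    outsider-≢ : ∀ {w u} → w ∉ p → u ∈ p → w ≢ u
    outsider-≢ w∉p u∈p refl = w∉p u∈p

    locate : TwinPair f x y z → ContainsTwins f p
    locate (inj₁ x~y) = x , y , x∈p , y∈p , x≢y ,
      λ w w∉p → x~y w (outsider-≢ w∉p x∈p) (outsider-≢ w∉p y∈p) (outsider-≢ w∉p z∈p)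
    locate (inj₂ (inj₁ x~z)) = x , z , x∈p , z∈p , x≢z ,
      λ w w∉p → x~z w (outsider-≢ w∉p x∈p) (outsider-≢ w∉p z∈p) (outsider-≢ w∉p y∈p)
    locate (inj₂ (inj₂ y~z)) = y , z , y∈p , z∈p , y≢z ,
      λ w w∉p → y~z w (outsider-≢ w∉p y∈p) (outsider-≢ w∉p z∈p) (outsider-≢ w∉p x∈p)

-- Distances

arc⇒≢ : {A : Digraph V} → Loopless A → ∀ {x y} → A x y ≡ true → x ≢ y
arc⇒≢ loopless {x} x→x refl = Bool.not-¬ x→x (loopless x)

Diameter≤2 : Digraph V → Set
Diameter≤2 A = ∀ x y → x ≢ y → A x y ≡ true ⊎ ∃[ m ] (A x m ≡ true × A m y ≡ true)

detour : {A : Digraph V} → Diameter≤2 A → ∀ {x y} → x ≢ y → A x y ≡ false →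
  ∃[ m ] (A x m ≡ true × A m y ≡ true)
detour diam {x} {y} x≢y x↛y with diam x y x≢y
... | inj₁ x→y  = contradiction x↛y (Bool.not-¬ x→y)
... | inj₂ path = path

module _ {A : Digraph V} where

  isDist-unique : ∀ {x y d e} → IsDist A x y d → IsDist A x y e → d ≡ e
  isDist-unique {d = d} {e} (p , p-shortest) (q , q-shortest) with ℕ.<-cmp d e
  ... | tri< d<e _ _ = contradiction p (q-shortest d d<e)
  ... | tri≈ _ d≡e _ = d≡e
  ... | tri> _ _ e<d = contradiction q (p-shortest e e<d)

  isDist-refl : ∀ {x} → IsDist A x x 0
  isDist-refl = nil , λ _ ()

  isDist-tail : ∀ {x y k} → IsDist A x y (suc k) → ∃[ a ] IsDist A a y k
  isDist-tail (cons x→a p , shortest) = _ , p , λ i i<k q → shortest (suc i) (s≤s i<k) (cons x→a q)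

  isDist-arc : ∀ {x y} → x ≢ y → A x y ≡ true → IsDist A x y 1
  isDist-arc {x} {y} x≢y x→y = cons x→y nil , shortest
    where
    shortest : ∀ k → k < 1 → ¬ Walk A x y k
    shortest zero    _        nil = x≢y refl
    shortest (suc _) (s≤s ()) _

  isDist-path : ∀ {x m y} → x ≢ y → A x y ≡ false → A x m ≡ true → A m y ≡ true → IsDist A x y 2
  isDist-path {x} {m} {y} x≢y x↛y x→m m→y = cons x→m (cons m→y nil) , shortest
    where
    shortest : ∀ k → k < 2 → ¬ Walk A x y k
    shortest zero          _              nil            = x≢y refl
    shortest (suc zero)    _              (cons x→y nil) = Bool.not-¬ x→y x↛y
    shortest (suc (suc _)) (s≤s (s≤s ())) _

walk? : (A : Digraph (Fin n)) → ∀ x y → Decidable (Walk A x y)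
walk? A x y zero = map′ (λ { refl → nil }) (λ { nil → refl }) (x ≟ y)
walk? A x y (suc k) = map′ (λ { (_ , x→z , p) → cons x→z p }) (λ { (cons x→z p) → _ , x→z , p })
  (any? λ z → (A x z Bool.≟ true) ×-dec walk? A z y k)

∃-least : {P : ℕ → Set} → Decidable P → ∃ P → ∃[ k ] (P k × (∀ m → m < k → ¬ P m))
∃-least {P} P? (k , Pk) = descend k (<-wellFounded k) Pk
  where
  descend : ∀ k → Acc _<_ k → P k → ∃[ k ] (P k × (∀ m → m < k → ¬ P m))
  descend k (acc smaller) Pk with ℕ.anyUpTo? P? k
  ... | yes (m , m<k , Pm) = descend m (smaller m<k) Pm
  ... | no none            = k , Pk , λ m m<k Pm → none (m , m<k , Pm)

arcType : Digraph V → V → V → Bool × Bool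
arcType A w v = A w v , A v w

infix 4 _≟ᵃ_
_≟ᵃ_ : DecidableEquality (Bool × Bool)
_≟ᵃ_ = ≡-dec Bool._≟_ Bool._≟_

OneWayArc : Digraph V → V → V → Set
OneWayArc A x y = arcType A x y ≡ (true , false)

TwinCondition : Digraph V → Set
TwinCondition A = TwinTriples (arcType A) × Diameter≤2 A

twinCondition-flip : {A : Digraph V} → TwinCondition A → TwinCondition (flip A)
twinCondition-flip {A = A} (triples , diam) =
  twinTriples-resp (λ _ _ → cong swap) triples , diam-flip
  where
  diam-flip : Diameter≤2 (flip A)
  diam-flip x y x≢y = ⊎-map₂ (λ (m , y→m , m→x) → m , m→x , y→m) (diam y x (≢-sym x≢y))

-- Weak metric dimension

module _ {A : Digraph (Fin n)} (connected : StronglyConnected A) where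

  private
    distance : ∀ x y → ∃ (IsDist A x y)
    distance x y = ∃-least (walk? A x y) (connected x y)

  ∂ : Fin n → Fin n → ℕ
  ∂ x y = proj₁ (distance x y)

  isDist-∂ : ∀ x y → IsDist A x y (∂ x y)
  isDist-∂ x y = proj₂ (distance x y)

  ∂-unique : ∀ {x y k} → IsDist A x y k → ∂ x y ≡ k
  ∂-unique = isDist-unique (isDist-∂ _ _)

  ∂≡0⇒≡ : ∀ {x y} → ∂ x y ≡ 0 → x ≡ y
  ∂≡0⇒≡ {x} {y} ∂≡0 with subst (IsDist A x y) ∂≡0 (isDist-∂ x y)
  ... | nil , _ = refl

  arc-via-∂ : ∀ {x y} → x ≢ y → A x y ≡ (∂ x y ≡ᵇ 1)
  arc-via-∂ {x} {y} x≢y with A x y in xy | ∂ x y | isDist-∂ x y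
  ... | true  | _           | dist rewrite isDist-unique dist (isDist-arc x≢y xy) = refl
  ... | false | 0           | _                = refl
  ... | false | 1           | cons x→y nil , _ = contradiction xy (Bool.not-¬ x→y)
  ... | false | suc (suc _) | _                = refl

  ∂-via-arc : Diameter≤2 A → ∀ {x y} → x ≢ y → ∂ x y ≡ (if A x y then 1 else 2)
  ∂-via-arc diam {x} {y} x≢y with A x y in xy
  ... | true  = ∂-unique (isDist-arc x≢y xy)
  ... | false with detour diam x≢y xy
  ... | _ , x→m , m→y = ∂-unique (isDist-path x≢y xy x→m m→y)

  private
    infix 4 _≟ᵈ_
    _≟ᵈ_ : DecidableEquality (ℕ × ℕ)
    _≟ᵈ_ = ≡-dec ℕ._≟_ ℕ._≟_

  ∂̃ : Fin n → Fin n → ℕ × ℕ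
  ∂̃ w v = ∂ w v , ∂ v w

  ∂̃-self : ∀ {u v} → u ≢ v → ∂̃ u u ≢ ∂̃ u v
  ∂̃-self u≢v eq = u≢v (∂≡0⇒≡ (trans (sym (cong proj₁ eq)) (∂-unique isDist-refl)))

  distinguishes⇔ : ∀ {w u v} → Distinguishes A w u v ⇔ (∂̃ w u ≢ ∂̃ w v)
  distinguishes⇔ = mk⇔
    (λ (_ , _ , _ , _ , wu , wv , uw , vw , neq) eq → neq (begin
      _ , _ ≡⟨ cong₂ _,_ (∂-unique wu) (∂-unique uw) ⟨
      ∂̃ _ _ ≡⟨ eq ⟩
      ∂̃ _ _ ≡⟨ cong₂ _,_ (∂-unique wv) (∂-unique vw) ⟩
      _ , _ ∎))
    (λ neq → _ , _ , _ , _ , isDist-∂ _ _ , isDist-∂ _ _ , isDist-∂ _ _ , isDist-∂ _ _ , neq)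
    where open ≡-Reasoning

  containsTwins? : Decidable (ContainsTwins ∂̃)
  containsTwins? p = any? λ u → any? λ v →
    (u Subset.∈? p) ×-dec (v Subset.∈? p) ×-dec ¬? (u ≟ v) ×-dec
    all? λ w → ¬? (w Subset.∈? p) →-dec (∂̃ w u ≟ᵈ ∂̃ w v)

  ¬containsTwins⇒resolving : ∀ {p} → ¬ ContainsTwins ∂̃ p → WeaklyResolving A (∁ p)
  ¬containsTwins⇒resolving {p} ¬twins u v u≢v = resolve (u Subset.∈? p) (v Subset.∈? p)
    where
    resolve : Dec (u ∈ p) → Dec (v ∈ p) → ∃[ w ] (w ∈ ∁ p × Distinguishes A w u v)
    resolve (no u∉p) _ = u , Subset.x∉p⇒x∈∁p u∉p , Equivalence.from distinguishes⇔ (∂̃-self u≢v)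
    resolve (yes _) (no v∉p) =
      v , Subset.x∉p⇒x∈∁p v∉p , Equivalence.from distinguishes⇔ (≢-sym (∂̃-self (≢-sym u≢v)))
    resolve (yes u∈p) (yes v∈p)
      with any? (λ w → ¬? (w Subset.∈? p) ×-dec ¬? (∂̃ w u ≟ᵈ ∂̃ w v))
    ... | yes (w , w∉p , ∂̃≢) = w , Subset.x∉p⇒x∈∁p w∉p , Equivalence.from distinguishes⇔ ∂̃≢
    ... | no none = contradiction
      (u , v , u∈p , v∈p , u≢v , λ w w∉p →
        decidable-stable (∂̃ w u ≟ᵈ ∂̃ w v) λ ∂̃≢ → none (w , w∉p , ∂̃≢))
      ¬twins

  containsTwins⇒¬resolving : ∀ {W} → ContainsTwins ∂̃ (∁ W) → ¬ WeaklyResolving A W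
  containsTwins⇒¬resolving (u , v , _ , _ , u≢v , agree) resolves with resolves u v u≢v
  ... | w , w∈W , distinguishes =
    Equivalence.to distinguishes⇔ distinguishes (agree w (Subset.x∈p⇒x∉∁p w∈W))

  dim≥n∸k⇔ : ∀ k →
    (∀ W → WeaklyResolving A W → n ∸ k ≤ ∣ W ∣) ⇔ (∀ p → k < ∣ p ∣ → ContainsTwins ∂̃ p)
  dim≥n∸k⇔ k = mk⇔ bound⇒twins twins⇒bound
    where
    bound⇒twins : (∀ W → WeaklyResolving A W → n ∸ k ≤ ∣ W ∣) → ∀ p → k < ∣ p ∣ → ContainsTwins ∂̃ p
    bound⇒twins bound p k<p = decidable-stable (containsTwins? p) λ ¬twins →
      ℕ.<⇒≱ (ℕ.∸-monoʳ-< k<p (Subset.∣p∣≤n p))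
        (subst (n ∸ k ≤_) (Subset.∣∁p∣≡n∸∣p∣ p) (bound (∁ p) (¬containsTwins⇒resolving ¬twins)))

    twins⇒bound : (∀ p → k < ∣ p ∣ → ContainsTwins ∂̃ p) → ∀ W → WeaklyResolving A W → n ∸ k ≤ ∣ W ∣
    twins⇒bound twins W resolves = ℕ.m≤n+o⇒m∸n≤o n k (begin
      n                    ≤⟨ ℕ.m≤n+m∸n n ∣ W ∣ ⟩
      ∣ W ∣ + (n ∸ ∣ W ∣)  ≡⟨ ℕ.+-comm ∣ W ∣ _ ⟩
      n ∸ ∣ W ∣ + ∣ W ∣    ≡⟨ cong (_+ ∣ W ∣) (Subset.∣∁p∣≡n∸∣p∣ W) ⟨
      ∣ ∁ W ∣ + ∣ W ∣      ≤⟨ ℕ.+-monoˡ-≤ ∣ W ∣ ∣∁W∣≤k ⟩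
      k + ∣ W ∣            ∎)
      where
      open ℕ.≤-Reasoning

      ∣∁W∣≤k : ∣ ∁ W ∣ ≤ k
      ∣∁W∣≤k = ℕ.≮⇒≥ λ k<∣∁W∣ → containsTwins⇒¬resolving (twins (∁ W) k<∣∁W∣) resolves

  ∁-pair-resolving : ∀ {a b c} → a ≢ b → a ≢ c → b ≢ c → ∂̃ a b ≢ ∂̃ a c →
    WeaklyResolving A (∁ (pair b c)) × ∣ ∁ (pair b c) ∣ ≤ n ∸ 2
  ∁-pair-resolving {a} {b} {c} a≢b a≢c b≢c separated = ¬containsTwins⇒resolving ¬twins ,
    subst (_≤ n ∸ 2) (sym (Subset.∣∁p∣≡n∸∣p∣ (pair b c))) (ℕ.∸-monoʳ-≤ n (2≤∣pair∣ b≢c))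
    where
    split : ∀ {u v} → u ≡ b ⊎ u ≡ c → v ≡ b ⊎ v ≡ c → u ≢ v → ∂̃ a u ≢ ∂̃ a v
    split (inj₁ refl) (inj₁ refl) u≢v = contradiction refl u≢v
    split (inj₁ refl) (inj₂ refl) _   = separated
    split (inj₂ refl) (inj₁ refl) _   = ≢-sym separated
    split (inj₂ refl) (inj₂ refl) u≢v = contradiction refl u≢v

    ¬twins : ¬ ContainsTwins ∂̃ (pair b c)
    ¬twins (u , v , u∈ , v∈ , u≢v , agree) =
      split (∈-pair⁻ u∈) (∈-pair⁻ v∈) u≢v (agree a ([ a≢b , a≢c ]′ ∘ ∈-pair⁻))

  one-way⇒separated : Loopless A → ∀ {a b} → OneWayArc A a b →
    ∃[ c ] (a ≢ c × b ≢ c × ∂̃ a b ≢ ∂̃ a c)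
  one-way⇒separated loopless {a} {b} a-b = c , ≢-sym c≢a , b≢c , separated
    where
    last-arc : ∀ {x y k} → Walk A x y (suc k) → ∃[ c ] (A c y ≡ true)
    last-arc (cons x→y nil)        = _ , x→y
    last-arc (cons _ p@(cons _ _)) = last-arc p

    in-neighbour : ∃[ c ] (A c a ≡ true)
    in-neighbour with connected b a
    ... | zero  , nil = contradiction refl (arc⇒≢ {A = A} loopless (cong proj₁ a-b))
    ... | suc _ , p   = last-arc p

    c : Fin n
    c = proj₁ in-neighbour

    c→a : A c a ≡ true
    c→a = proj₂ in-neighbour

    c≢a : c ≢ a
    c≢a = arc⇒≢ {A = A} loopless c→a

    b≢c : b ≢ c
    b≢c b≡c = Bool.not-¬ c→a (subst (λ v → A v a ≡ false) b≡c (cong proj₂ a-b))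

    b≢a : b ≢ a
    b≢a = ≢-sym (arc⇒≢ {A = A} loopless (cong proj₁ a-b))

    separated : ∂̃ a b ≢ ∂̃ a c
    separated eq = Bool.not-¬ c→a (begin
      A c a         ≡⟨ arc-via-∂ c≢a ⟩
      (∂ c a ≡ᵇ 1)  ≡⟨ cong ((_≡ᵇ 1) ∘ proj₂) eq ⟨
      (∂ b a ≡ᵇ 1)  ≡⟨ arc-via-∂ b≢a ⟨
      A b a         ≡⟨ cong proj₂ a-b ⟩
      false         ∎)
      where open ≡-Reasoning

  dim≡n∸2⇔twinTriples : Loopless A → ∀ {a b} → OneWayArc A a b →
    HasDim A (n ∸ 2) ⇔ TwinTriples ∂̃
  dim≡n∸2⇔twinTriples loopless {a} {b} a-b = mk⇔
    (λ (_ , bound) → Equivalence.to lower-bound⇔ bound)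
    (λ triples → attained (Equivalence.from lower-bound⇔ triples))
    where
    attained : (∀ W → WeaklyResolving A W → n ∸ 2 ≤ ∣ W ∣) → HasDim A (n ∸ 2)
    attained bound with one-way⇒separated loopless a-b
    ... | _ , a≢c , b≢c , separated
      with ∁-pair-resolving (arc⇒≢ {A = A} loopless (cong proj₁ a-b)) a≢c b≢c separated
    ... | resolves , size≤ = (_ , resolves , ℕ.≤-antisym size≤ (bound _ resolves)) , bound

    lower-bound⇔ : (∀ W → WeaklyResolving A W → n ∸ 2 ≤ ∣ W ∣) ⇔ TwinTriples ∂̃
    lower-bound⇔ = twinTriples⇔ ⇔-∘ dim≥n∸k⇔ 2

  -- The first three vertices of a geodesic of length at least 3 are at pairwise distinct
  -- distances from its endpoint.
  twinTriples⇒diameter≤2 : TwinTriples ∂̃ → Diameter≤2 A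
  twinTriples⇒diameter≤2 triples x y x≢y with ∂ x y | isDist-∂ x y
  ... | 0 | nil , _                     = contradiction refl x≢y
  ... | 1 | cons x→y nil , _            = inj₁ x→y
  ... | 2 | cons x→m (cons m→y nil) , _ = inj₂ (_ , x→m , m→y)
  ... | suc (suc (suc _)) | x-y with isDist-tail x-y
  ... | a , a-y with isDist-tail a-y
  ... | b , b-y = contradiction (λ ()) (no-three-values triples
    (y≢ x-y) (y≢ a-y) (y≢ b-y) (∂̃-to x-y) (∂̃-to a-y) (∂̃-to b-y) (λ ()) (λ ()))
    where
    y≢ : ∀ {u i} → IsDist A u y (suc i) → y ≢ u
    y≢ u-y refl = contradiction (isDist-unique u-y isDist-refl) λ ()

    ∂̃-to : ∀ {u i} → IsDist A u y i → ∂̃ y u ≡ (∂ y u , i)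
    ∂̃-to u-y = cong (∂ y _ ,_) (∂-unique u-y)

  twinTriples⇔twinCondition : TwinTriples ∂̃ ⇔ TwinCondition A
  twinTriples⇔twinCondition = mk⇔
    (λ triples → twinTriples-resp ∂̃⇒arcType triples , twinTriples⇒diameter≤2 triples)
    (λ (triples , diam) → twinTriples-resp (arcType⇒∂̃ diam) triples)
    where
    same-arc : ∀ {x y x′ y′} → x ≢ y → x′ ≢ y′ → ∂ x y ≡ ∂ x′ y′ → A x y ≡ A x′ y′
    same-arc x≢y x′≢y′ eq = trans (arc-via-∂ x≢y) (trans (cong (_≡ᵇ 1) eq) (sym (arc-via-∂ x′≢y′)))

    ∂̃⇒arcType : ∀ {w x y} → w ≢ x → w ≢ y → ∂̃ w x ≡ ∂̃ w y → arcType A w x ≡ arcType A w y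
    ∂̃⇒arcType w≢x w≢y eq = cong₂ _,_
      (same-arc w≢x w≢y (cong proj₁ eq)) (same-arc (≢-sym w≢x) (≢-sym w≢y) (cong proj₂ eq))

    same-∂ : Diameter≤2 A → ∀ {x y x′ y′} → x ≢ y → x′ ≢ y′ → A x y ≡ A x′ y′ → ∂ x y ≡ ∂ x′ y′
    same-∂ diam x≢y x′≢y′ eq = trans (∂-via-arc diam x≢y)
      (trans (cong (λ b → if b then 1 else 2) eq) (sym (∂-via-arc diam x′≢y′)))

    arcType⇒∂̃ : Diameter≤2 A → ∀ {w x y} → w ≢ x → w ≢ y →
      arcType A w x ≡ arcType A w y → ∂̃ w x ≡ ∂̃ w y
    arcType⇒∂̃ diam w≢x w≢y eq = cong₂ _,_
      (same-∂ diam w≢x w≢y (cong proj₁ eq)) (same-∂ diam (≢-sym w≢x) (≢-sym w≢y) (cong proj₂ eq))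

-- Fibres

Fibre : (V → U) → U → Set
Fibre c i = ∃[ x ] c x ≡ i

↔Σ-Fibre : (c : V → U) → V ↔ Σ U (Fibre c)
↔Σ-Fibre c = mk↔ₛ′ (λ x → c x , x , refl) (λ (_ , x , _) → x)
  (λ { (_ , _ , refl) → refl }) (λ _ → refl)

Σ-Fin-suc↔ : {P : Fin (suc m) → Set} → (P zero ⊎ Σ (Fin m) (P ∘ suc)) ↔ Σ (Fin (suc m)) P
Σ-Fin-suc↔ = mk↔ₛ′
  (λ { (inj₁ p) → zero , p ; (inj₂ (i , p)) → suc i , p })
  (λ { (zero , p) → inj₁ p ; (suc i , p) → inj₂ (i , p) })
  (λ { (zero , _) → refl ; (suc _ , _) → refl })
  (λ { (inj₁ _) → refl ; (inj₂ _) → refl })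

Fin-sum↔Σ : (s : Fin m → ℕ) → Fin (sum s) ↔ Σ (Fin m) (Fin ∘ s)
Fin-sum↔Σ {zero}  s = mk↔ₛ′ (λ ()) (λ ()) (λ ()) (λ ())
Fin-sum↔Σ {suc m} s =
  Fin (s zero + sum (s ∘ suc))                ↔⟨ +↔⊎ ⟩
  (Fin (s zero) ⊎ Fin (sum (s ∘ suc)))        ↔⟨ ⊎-cong (↔-id _) (Fin-sum↔Σ (s ∘ suc)) ⟩
  (Fin (s zero) ⊎ Σ (Fin m) (Fin ∘ s ∘ suc))  ↔⟨ Σ-Fin-suc↔ ⟩
  Σ (Fin (suc m)) (Fin ∘ s)                   ∎
  where open EquationalReasoning

fibreSize : (Fin n → Fin m) → Fin m → ℕ
fibreSize c i = sum λ x → if does (c x ≟ i) then 1 else 0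

Fin-fibreSize↔Fibre : (c : Fin n → Fin m) (i : Fin m) → Fin (fibreSize c i) ↔ Fibre c i
Fin-fibreSize↔Fibre c i = Σ-↔ (↔-id _) (λ {x} → indicator↔ (c x ≟ i)) ↔-∘ Fin-sum↔Σ _
  where
  indicator↔ : ∀ {j} (j≟i : Dec (j ≡ i)) → Fin (if does j≟i then 1 else 0) ↔ (j ≡ i)
  indicator↔ (yes refl) =
    mk↔ₛ′ {A = Fin 1} (λ _ → refl) (λ _ → 0F) (λ { refl → refl }) (λ { 0F → refl })
  indicator↔ (no j≢i)   = mk↔ₛ′
    (λ ()) (λ j≡i → contradiction j≡i j≢i) (λ j≡i → contradiction j≡i j≢i) (λ ())

sum-fibreSize : (c : Fin n → Fin m) → sum (fibreSize c) ≡ n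
sum-fibreSize {n} {m} c = ↔⇒≡ (
  Fin (sum (fibreSize c))        ↔⟨ Fin-sum↔Σ (fibreSize c) ⟩
  Σ (Fin m) (Fin ∘ fibreSize c)  ↔⟨ Σ-↔ (↔-id _) (Fin-fibreSize↔Fibre c _) ⟩
  Σ (Fin m) (Fibre c)            ↔⟨ ↔Σ-Fibre c ⟨
  Fin n                          ∎)
  where open EquationalReasoning

fibreSize-positive : (c : Fin n → Fin m) {i : Fin m} → Fibre c i → 1 ≤ fibreSize c i
fibreSize-positive c {i} x with fibreSize c i | Inverse.from (Fin-fibreSize↔Fibre c i) x
... | suc _ | _ = s≤s z≤n

-- Blow-ups

-- The vertices of each colour are pairwise joined or not according to the diagonal of M, and
-- the colours in S are used once.
record BlowUp (M : Digraph (Fin m)) (S : Subset m) (A : Digraph V) : Set where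
  field
    colour : V → Fin m
    onto   : ∀ i → Fibre colour i
    single : ∀ {x y} → colour x ∈ S → colour x ≡ colour y → x ≡ y
    arcs   : ∀ {x y} → x ≢ y → A x y ≡ M (colour x) (colour y)

  arcType-colour : ∀ {x y} → x ≢ y → arcType A x y ≡ arcType M (colour x) (colour y)
  arcType-colour x≢y = cong₂ _,_ (arcs x≢y) (arcs (≢-sym x≢y))

  single-fibre : ∀ {i} → i ∈ S → Unit ↔ Fibre colour i
  single-fibre {i} i∈S with onto i
  ... | x , refl = mk↔ₛ′ (λ _ → x , refl) (λ _ → tt) unique (λ _ → refl)
    where
    unique : ∀ y → (x , refl) ≡ y
    unique (y , eq) = same-vertex (single i∈S (sym eq)) eq
      where
      same-vertex : ∀ {y} → x ≡ y → (eq : colour y ≡ colour x) → (x , refl) ≡ (y , eq)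
      same-vertex refl refl = refl

blowUp-flip : {M : Digraph (Fin m)} {S : Subset m} {A : Digraph V} →
  BlowUp M S A → BlowUp (flip M) S (flip A)
blowUp-flip blowUp = record
  { colour = colour ; onto = onto ; single = single ; arcs = arcs ∘ ≢-sym }
  where open BlowUp blowUp

blowUp-iso : {M : Digraph (Fin m)} {S : Subset m} {A : Digraph V} {B : Digraph U} →
  Iso A B → BlowUp M S B → BlowUp M S A
blowUp-iso (f , f-arcs) blowUp = record
  { colour = colour ∘ to
  ; onto   = λ i → let y , cy≡i = onto i in from y , trans (cong colour (strictlyInverseˡ y)) cy≡i
  ; single = λ c∈S eq → injective (single c∈S eq)
  ; arcs   = λ x≢y → trans (f-arcs _ _) (arcs (x≢y ∘ injective))
  }
  where
  open BlowUp blowUp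
  open Inverse f
  open Injection (↔⇒↣ f) using (injective)

blowUp-recolour : {M M′ : Digraph (Fin m)} {S S′ : Subset m} {A : Digraph V} (π : Iso M M′) →
  (∀ i → Inverse.to (proj₁ π) i ∈ S′ → i ∈ S) → BlowUp M S A → BlowUp M′ S′ A
blowUp-recolour (π , π-arcs) π-single blowUp = record
  { colour = to ∘ colour
  ; onto   = λ i → let x , cx≡ = onto (from i) in x , trans (cong to cx≡) (strictlyInverseˡ i)
  ; single = λ c∈S′ eq → single (π-single _ c∈S′) (injective eq)
  ; arcs   = λ x≢y → trans (arcs x≢y) (π-arcs _ _)
  }
  where
  open BlowUp blowUp
  open Inverse π
  open Injection (↔⇒↣ π) using (injective)

blowUp-unique : {M : Digraph (Fin m)} {S : Subset m} {A : Digraph (Fin n)} {B : Digraph U} →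
  Loopless A → Loopless B → (a : BlowUp M S A) (b : BlowUp M S B) →
  (∀ i → i ∉ S → Fibre (BlowUp.colour a) i ↔ Fibre (BlowUp.colour b) i) → Iso A B
blowUp-unique {m = m} {n} {U} {M} {S} {A} {B} A-loopless B-loopless a b fibres↔ = f , preserves
  where
  module a = BlowUp a
  module b = BlowUp b

  fibre↔ : ∀ i → Fibre a.colour i ↔ Fibre b.colour i
  fibre↔ i with i Subset.∈? S
  ... | yes i∈S = b.single-fibre i∈S ↔-∘ ↔-sym (a.single-fibre i∈S)
  ... | no i∉S  = fibres↔ i i∉S

  f : Fin n ↔ U
  f = Fin n                       ↔⟨ ↔Σ-Fibre a.colour ⟩
      Σ (Fin m) (Fibre a.colour)  ↔⟨ Σ-↔ (↔-id _) (fibre↔ _) ⟩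
      Σ (Fin m) (Fibre b.colour)  ↔⟨ ↔Σ-Fibre b.colour ⟨
      U                           ∎
    where open EquationalReasoning

  open Inverse f using (to)
  open Injection (↔⇒↣ f) using (injective)

  colour-to : ∀ x → b.colour (to x) ≡ a.colour x
  colour-to x = proj₂ (Inverse.to (fibre↔ (a.colour x)) (x , refl))

  preserves : ∀ x y → A x y ≡ B (to x) (to y)
  preserves x y with x ≟ y
  ... | yes refl = trans (A-loopless x) (sym (B-loopless (to x)))
  ... | no x≢y   = begin
    A x y                                  ≡⟨ a.arcs x≢y ⟩
    M (a.colour x) (a.colour y)            ≡⟨ cong₂ M (colour-to x) (colour-to y) ⟨
    M (b.colour (to x)) (b.colour (to y))  ≡⟨ b.arcs (x≢y ∘ injective) ⟨
    B (to x) (to y)                        ∎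
    where open ≡-Reasoning

blowUp-from-relation : {M : Digraph (Fin m)} {S : Subset m} {A : Digraph V}
  (_HasColour_ : V → Fin m → Set) →
  (∀ x → ∃[ i ] x HasColour i) → (∀ i → ∃[ x ] x HasColour i) →
  (∀ {x i j} → x HasColour i → x HasColour j → i ≡ j) →
  (∀ {x y i} → i ∈ S → x HasColour i → y HasColour i → x ≡ y) →
  (∀ {x y i j} → x ≢ y → x HasColour i → y HasColour j → A x y ≡ M i j) →
  BlowUp M S A
blowUp-from-relation _HasColour_ total onto functional single arcs = record
  { colour = λ x → proj₁ (total x)
  ; onto   = λ i → let x , xi = onto i in x , functional (proj₂ (total x)) xi
  ; single = λ {x} {y} c∈S eq →
      single c∈S (proj₂ (total x)) (subst (y HasColour_) (sym eq) (proj₂ (total y)))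
  ; arcs   = λ {x} {y} x≢y → arcs x≢y (proj₂ (total x)) (proj₂ (total y))
  }

DistinctRows : Digraph (Fin m) → Set
DistinctRows M = ∀ i j → (∀ k → M i k ≡ M j k) → i ≡ j

distinctRows? : (M : Digraph (Fin m)) → Dec (DistinctRows M)
distinctRows? M = all? λ i → all? λ j → all? (λ k → M i k Bool.≟ M j k) →-dec (i ≟ j)

blowUp-from-vertices : {M : Digraph (Fin m)} {A : Digraph V} →
  DistinctRows M → (vertex : Fin m → V) → (∀ x → ∃[ i ] vertex i ≡ x) →
  (∀ i j → A (vertex i) (vertex j) ≡ M i j) → BlowUp M ⊤ A
blowUp-from-vertices {M = M} {A} distinct vertex covers arcs =
  blowUp-from-relation (λ x i → vertex i ≡ x) covers (λ i → vertex i , refl)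
    (λ i≡x j≡x → injective (trans i≡x (sym j≡x)))
    (λ _ i≡x i≡y → trans (sym i≡x) i≡y)
    (λ { _ refl refl → arcs _ _ })
  where
  open ≡-Reasoning

  injective : ∀ {i j} → vertex i ≡ vertex j → i ≡ j
  injective {i} {j} eq = distinct i j λ k → begin
    M i k                    ≡⟨ arcs i k ⟨
    A (vertex i) (vertex k)  ≡⟨ cong (λ x → A x (vertex k)) eq ⟩
    A (vertex j) (vertex k)  ≡⟨ arcs j k ⟩
    M j k                    ∎

module _ (M : Digraph (Fin m)) (S : Subset m) where

  -- A vertex of colour l besides three given ones of colours i, j and k exists only if l ∉ S or
  -- l differs from i, j and k.
  ColourTwinsUpTo : Fin m → Fin m → Fin m → Set
  ColourTwinsUpTo k i j = ∀ l → (l ∈ S × (l ≡ i ⊎ l ≡ j ⊎ l ≡ k)) ⊎ arcType M l i ≡ arcType M l j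

  ColourTwinTriples : Set
  ColourTwinTriples = ∀ i j k → i ≢ j → i ≢ k → j ≢ k →
    ColourTwinsUpTo k i j ⊎ ColourTwinsUpTo j i k ⊎ ColourTwinsUpTo i j k

  ColourDiameter≤2 : Set
  ColourDiameter≤2 = ∀ i j → (i ∈ S × i ≡ j) ⊎ M i j ≡ true ⊎
    ∃[ l ] (l ≢ i × l ≢ j × M i l ≡ true × M l j ≡ true)

  private
    colourTwinsUpTo? : ∀ k i j → Dec (ColourTwinsUpTo k i j)
    colourTwinsUpTo? k i j = all? λ l →
      ((l Subset.∈? S) ×-dec (l ≟ i ⊎-dec l ≟ j ⊎-dec l ≟ k)) ⊎-dec
      (arcType M l i ≟ᵃ arcType M l j)

  colourTwinTriples? : Dec ColourTwinTriples
  colourTwinTriples? = all? λ i → all? λ j → all? λ k →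
    ¬? (i ≟ j) →-dec ¬? (i ≟ k) →-dec ¬? (j ≟ k) →-dec
    (colourTwinsUpTo? k i j ⊎-dec colourTwinsUpTo? j i k ⊎-dec colourTwinsUpTo? i j k)

  colourDiameter≤2? : Dec ColourDiameter≤2
  colourDiameter≤2? = all? λ i → all? λ j →
    ((i Subset.∈? S) ×-dec (i ≟ j)) ⊎-dec (M i j Bool.≟ true) ⊎-dec
    any? λ l → ¬? (l ≟ i) ×-dec ¬? (l ≟ j) ×-dec (M i l Bool.≟ true) ×-dec (M l j Bool.≟ true)

module _ {M : Digraph (Fin m)} {S : Subset m} {A : Digraph V} (blowUp : BlowUp M S A) where
  open BlowUp blowUp

  private
    colourTwins⇒twins : ∀ {z x y} → ColourTwinsUpTo M S (colour z) (colour x) (colour y) →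
      TwinsUpTo (arcType A) z x y
    colourTwins⇒twins twins w w≢x w≢y w≢z with twins (colour w)
    ... | inj₁ (w∈S , inj₁ eq)        = contradiction (single w∈S eq) w≢x
    ... | inj₁ (w∈S , inj₂ (inj₁ eq)) = contradiction (single w∈S eq) w≢y
    ... | inj₁ (w∈S , inj₂ (inj₂ eq)) = contradiction (single w∈S eq) w≢z
    ... | inj₂ eq = trans (arcType-colour w≢x) (trans eq (sym (arcType-colour w≢y)))

    same-colour⇒twins : ∀ {z x y} → colour x ≡ colour y → TwinsUpTo (arcType A) z x y
    same-colour⇒twins x≈y = colourTwins⇒twins λ l → inj₂ (cong (arcType M l) x≈y)

  blowUp-twinTriples : ColourTwinTriples M S → TwinTriples (arcType A)
  blowUp-twinTriples triples x y z _ _ _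
    with colour x ≟ colour y | colour x ≟ colour z | colour y ≟ colour z
  ... | yes x≈y | _       | _       = inj₁ (same-colour⇒twins x≈y)
  ... | no _    | yes x≈z | _       = inj₂ (inj₁ (same-colour⇒twins x≈z))
  ... | no _    | no _    | yes y≈z = inj₂ (inj₂ (same-colour⇒twins y≈z))
  ... | no x≉y  | no x≉z  | no y≉z  =
    ⊎-map colourTwins⇒twins (⊎-map colourTwins⇒twins colourTwins⇒twins) (triples _ _ _ x≉y x≉z y≉z)

  blowUp-diameter≤2 : ColourDiameter≤2 M S → Diameter≤2 A
  blowUp-diameter≤2 diam x y x≢y with diam (colour x) (colour y)
  ... | inj₁ (x∈S , x≈y)  = contradiction (single x∈S x≈y) x≢y
  ... | inj₂ (inj₁ x→y)   = inj₁ (trans (arcs x≢y) x→y)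
  ... | inj₂ (inj₂ (l , l≢x , l≢y , x→l , l→y)) with onto l
  ... | z , refl = inj₂
    (z , trans (arcs λ { refl → l≢x refl }) x→l , trans (arcs λ { refl → l≢y refl }) l→y)

-- Lexicographic products as blow-ups

Uniform : Bool → Digraph V → Set
Uniform b A = ∀ {x y} → x ≢ y → A x y ≡ b

K-uniform : ∀ t → Uniform true (K t)
K-uniform t {x} {y} x≢y with x ≟ y
... | yes x≡y = contradiction x≡y x≢y
... | no _    = refl

K-loopless : ∀ t → Loopless (K t)
K-loopless t x with x ≟ x
... | yes _  = refl
... | no x≢x = contradiction refl x≢x

_withLoopsAt_ : Digraph (Fin m) → Subset m → Digraph (Fin m)
(G withLoopsAt D) i j = if does (i ≟ j) then lookup D i else G i j

module _ (G : Digraph (Fin m)) (s : Fin m → ℕ) (H : ∀ i → Digraph (Fin (s i))) where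

  Lex-loopless : (∀ i → Loopless (H i)) → Loopless (Lex G s H)
  Lex-loopless loopless (i , x) with i ≟ i
  ... | yes refl = loopless i x
  ... | no i≢i   = contradiction refl i≢i

  Lex-blowUp : (D : Subset m) {S : Subset m} → (∀ i → Uniform (lookup D i) (H i)) →
    (∀ i → 1 ≤ s i) → (∀ {i} → i ∈ S → s i ≡ 1) → BlowUp (G withLoopsAt D) S (Lex G s H)
  Lex-blowUp D uniform nonempty singleton = record
    { colour = proj₁
    ; onto   = λ i → (i , fromℕ< (nonempty i)) , refl
    ; single = λ { {i , x} {_ , y} i∈S refl → cong (i ,_) (Fin1-unique (singleton i∈S) x y) }
    ; arcs   = λ {x} {y} → Lex-arcs x y
    }
    where
    Fin1-unique : ∀ {k} → k ≡ 1 → (x y : Fin k) → x ≡ y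
    Fin1-unique refl 0F 0F = refl

    Lex-arcs : ∀ p q → p ≢ q → Lex G s H p q ≡ (G withLoopsAt D) (proj₁ p) (proj₁ q)
    Lex-arcs (i , x) (j , y) p≢q with i ≟ j
    ... | yes refl = uniform i λ { refl → p≢q refl }
    ... | no _     = refl

proj₁-fibre↔ : {s : Fin m → ℕ} (i : Fin m) → Fin (s i) ↔ Fibre {V = Σ (Fin m) (Fin ∘ s)} proj₁ i
proj₁-fibre↔ i = mk↔ₛ′ (λ x → (i , x) , refl) (λ { ((_ , x) , refl) → x })
  (λ { (_ , refl) → refl }) (λ _ → refl)

fibreSize-single : {M : Digraph (Fin m)} {S : Subset m} {A : Digraph (Fin n)} →
  (blowUp : BlowUp M S A) → ∀ {i} → i ∈ S → fibreSize (BlowUp.colour blowUp) i ≡ 1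
fibreSize-single blowUp {i} i∈S = ↔⇒≡ (
  Fin (fibreSize colour i)  ↔⟨ Fin-fibreSize↔Fibre colour i ⟩
  Fibre colour i            ↔⟨ single-fibre i∈S ⟨
  Unit                      ↔⟨ 1↔⊤ ⟨
  Fin 1                     ∎)
  where
  open BlowUp blowUp
  open EquationalReasoning

blowUp⇒iso-Lex : (G : Digraph (Fin m)) (s : Fin m → ℕ) (H : ∀ i → Digraph (Fin (s i)))
  (D : Subset m) {S : Subset m} {A : Digraph (Fin n)} → Loopless A → (∀ i → Loopless (H i)) →
  (∀ i → Uniform (lookup D i) (H i)) → (blowUp : BlowUp (G withLoopsAt D) S A) →
  (∀ i → fibreSize (BlowUp.colour blowUp) i ≡ s i) → Iso A (Lex G s H)
blowUp⇒iso-Lex G s H D A-loopless H-loopless uniform blowUp sizes =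
  blowUp-unique A-loopless (Lex-loopless G s H H-loopless) blowUp
    (Lex-blowUp G s H D uniform
      (λ i → subst (1 ≤_) (sizes i) (fibreSize-positive colour (onto i)))
      (λ {i} i∈S → trans (sym (sizes i)) (fibreSize-single blowUp i∈S)))
    λ i _ →
      Fibre colour i            ↔⟨ Fin-fibreSize↔Fibre colour i ⟨
      Fin (fibreSize colour i)  ↔⟨ cast-id (sizes i) ⟩
      Fin (s i)                 ↔⟨ proj₁-fibre↔ i ⟩
      Fibre proj₁ i             ∎
  where
  open BlowUp blowUp
  open EquationalReasoning

blowUp-refl : (M : Digraph (Fin m)) → BlowUp M ⊤ M
blowUp-refl M = record
  { colour = λ i → i ; onto = λ i → i , refl ; single = λ _ i≡j → i≡j ; arcs = λ _ → refl }

-- The extremal digraphs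

comp3-loopless : ∀ {a b c} {H₀ : Digraph (Fin a)} {H₁ : Digraph (Fin b)} {H₂ : Digraph (Fin c)} →
  Loopless H₀ → Loopless H₁ → Loopless H₂ → ∀ i → Loopless (comp3 H₀ H₁ H₂ i)
comp3-loopless l₀ l₁ l₂ 0F = l₀
comp3-loopless l₀ l₁ l₂ 1F = l₁
comp3-loopless l₀ l₁ l₂ 2F = l₂

K,K,K-uniform : ∀ {a b c} i → Uniform (lookup ⊤ i) (comp3 (K a) (K b) (K c) i)
K,K,K-uniform 0F = K-uniform _
K,K,K-uniform 1F = K-uniform _
K,K,K-uniform 2F = K-uniform _

K,K̄,K-uniform : ∀ {a b c} i → Uniform (lookup (∁ ⁅ 1F ⁆) i) (comp3 (K a) (Kbar b) (K c) i)
K,K̄,K-uniform 0F = K-uniform _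
K,K̄,K-uniform 1F = λ _ → refl
K,K̄,K-uniform 2F = K-uniform _

P2-loopless : Loopless P2
P2-loopless 0F = refl
P2-loopless 1F = refl

vertices-G2-P₂ : Fin 4 ↔ Σ (Fin 3) (Fin ∘ size3 1 2 1)
vertices-G2-P₂ = Fin-sum↔Σ (size3 1 2 1)

G2-P₂ : Digraph (Fin 4)
G2-P₂ i j = Lex3 G2 (K 1) P2 (K 1) (to i) (to j)
  where open Inverse vertices-G2-P₂

K₁,P₂,K₁-blowUp : BlowUp G2-P₂ ⊤ (Lex3 G2 (K 1) P2 (K 1))
K₁,P₂,K₁-blowUp = blowUp-iso (↔-sym vertices-G2-P₂ , pulled-back) (blowUp-refl G2-P₂)
  where
  open Inverse vertices-G2-P₂

  pulled-back : ∀ p q → Lex3 G2 (K 1) P2 (K 1) p q ≡ G2-P₂ (from p) (from q)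
  pulled-back p q = sym (cong₂ (Lex3 G2 (K 1) P2 (K 1)) (strictlyInverseˡ p) (strictlyInverseˡ q))

data Shape (A : Digraph V) : Set where
  G1[K₁,K,K]   : BlowUp (G1 withLoopsAt ⊤) ⁅ 0F ⁆ A → Shape A
  G2[K₁,K,K]   : BlowUp (G2 withLoopsAt ⊤) ⁅ 0F ⁆ A → Shape A
  G2[K,K,K₁]   : BlowUp (G2 withLoopsAt ⊤) ⁅ 2F ⁆ A → Shape A
  G2[K₁,K̄,K₁]  : BlowUp (G2 withLoopsAt (∁ ⁅ 1F ⁆)) (∁ ⁅ 1F ⁆) A → Shape A
  G2[K₁,P₂,K₁] : BlowUp G2-P₂ ⊤ A → Shape A

K₁,K,K-blowUp : ∀ G {b c} → 1 ≤ b → 1 ≤ c →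
  BlowUp (G withLoopsAt ⊤) ⁅ 0F ⁆ (Lex3 G (K 1) (K b) (K c))
K₁,K,K-blowUp G 1≤b 1≤c = Lex-blowUp G _ _ ⊤ K,K,K-uniform
  (λ { 0F → ℕ.≤-refl ; 1F → 1≤b ; 2F → 1≤c })
  (λ { here → refl ; (there (there (there ()))) })

K,K,K₁-blowUp : ∀ G {a b} → 1 ≤ a → 1 ≤ b →
  BlowUp (G withLoopsAt ⊤) ⁅ 2F ⁆ (Lex3 G (K a) (K b) (K 1))
K,K,K₁-blowUp G 1≤a 1≤b = Lex-blowUp G _ _ ⊤ K,K,K-uniform
  (λ { 0F → 1≤a ; 1F → 1≤b ; 2F → ℕ.≤-refl })
  (λ { (there (there here)) → refl })

K₁,K̄,K₁-blowUp : ∀ G {b} → 1 ≤ b →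
  BlowUp (G withLoopsAt (∁ ⁅ 1F ⁆)) (∁ ⁅ 1F ⁆) (Lex3 G (K 1) (Kbar b) (K 1))
K₁,K̄,K₁-blowUp G 1≤b = Lex-blowUp G _ _ (∁ ⁅ 1F ⁆) K,K̄,K-uniform
  (λ { 0F → ℕ.≤-refl ; 1F → 1≤b ; 2F → ℕ.≤-refl })
  (λ { here → refl ; (there (there here)) → refl })

extremal⇒shape : {A : Digraph (Fin n)} → 4 ≤ n → Extremal n A → Shape A
extremal⇒shape _ (inj₁ iso) = G2[K₁,P₂,K₁] (blowUp-iso iso K₁,P₂,K₁-blowUp)
extremal⇒shape {n} {A} 4≤n (inj₂ (inj₁ (t , 1≤t , t≤n∸2 , isos))) = shape isos
  where
  1≤n∸t∸1 : 1 ≤ n ∸ t ∸ 1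
  1≤n∸t∸1 = ℕ.∸-monoˡ-≤ 1 (ℕ.m+n≤o⇒m≤o∸n 2 (subst (_≤ n) (ℕ.+-comm t 2)
    (ℕ.m≤o∸n⇒m+n≤o t (ℕ.≤-trans (ℕ.m≤m+n 2 2) 4≤n) t≤n∸2)))

  shape : Iso A (Lex3 G1 (K 1) (K t) (K (n ∸ t ∸ 1))) ⊎ Iso A (Lex3 G2 (K 1) (K t) (K (n ∸ t ∸ 1)))
    ⊎ Iso A (Lex3 G2 (K t) (K (n ∸ t ∸ 1)) (K 1)) → Shape A
  shape (inj₁ iso)        = G1[K₁,K,K] (blowUp-iso iso (K₁,K,K-blowUp G1 1≤t 1≤n∸t∸1))
  shape (inj₂ (inj₁ iso)) = G2[K₁,K,K] (blowUp-iso iso (K₁,K,K-blowUp G2 1≤t 1≤n∸t∸1))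
  shape (inj₂ (inj₂ iso)) = G2[K,K,K₁] (blowUp-iso iso (K,K,K₁-blowUp G2 1≤t 1≤n∸t∸1))
extremal⇒shape 4≤n (inj₂ (inj₂ iso)) =
  G2[K₁,K̄,K₁] (blowUp-iso iso (K₁,K̄,K₁-blowUp G2 (ℕ.≤-trans (ℕ.n≤1+n 1) (ℕ.∸-monoˡ-≤ 2 4≤n))))

t+1+s≡n⇒s≡n∸t∸1 : ∀ {t s} → t + suc s ≡ n → s ≡ n ∸ t ∸ 1
t+1+s≡n⇒s≡n∸t∸1 {t = t} {s} refl = sym (cong (_∸ 1) (ℕ.m+n∸m≡n t (suc s)))

t+1+s≡n⇒t≤n∸2 : ∀ {t s} → 1 ≤ s → t + suc s ≡ n → t ≤ n ∸ 2
t+1+s≡n⇒t≤n∸2 {t = t} 1≤s refl = ℕ.m+n≤o⇒m≤o∸n t (ℕ.+-monoʳ-≤ t (s≤s 1≤s))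

module _ {A : Digraph (Fin n)} (loopless : Loopless A) where

  private
    module Sizes {M : Digraph (Fin 3)} {S : Subset 3} (blowUp : BlowUp M S A) where
      open BlowUp blowUp
      open ≡-Reasoning

      size : Fin 3 → ℕ
      size = fibreSize colour

      size-positive : ∀ i → 1 ≤ size i
      size-positive i = fibreSize-positive colour (onto i)

      size-single : ∀ {i} → i ∈ S → size i ≡ 1
      size-single = fibreSize-single blowUp

      size₁+size₂ : 0F ∈ S → size 1F + suc (size 2F) ≡ n
      size₁+size₂ 0∈S = begin
        size 1F + suc (size 2F)        ≡⟨ ℕ.+-suc (size 1F) (size 2F) ⟩
        1 + (size 1F + size 2F)        ≡⟨ cong (_+ (size 1F + size 2F)) (size-single 0∈S) ⟨
        size 0F + (size 1F + size 2F)  ≡⟨ cong (λ c → size 0F + (size 1F + c)) (ℕ.+-identityʳ _) ⟨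
        sum size                       ≡⟨ sum-fibreSize colour ⟩
        n                              ∎

      size₀+size₁ : 2F ∈ S → size 0F + suc (size 1F) ≡ n
      size₀+size₁ 2∈S = begin
        size 0F + suc (size 1F)        ≡⟨ cong (size 0F +_) (ℕ.+-comm 1 (size 1F)) ⟩
        size 0F + (size 1F + (1 + 0))  ≡⟨ cong (λ c → size 0F + (size 1F + (c + 0))) (size-single 2∈S) ⟨
        sum size                       ≡⟨ sum-fibreSize colour ⟩
        n                              ∎

      size₁≡n∸2 : 0F ∈ S → 2F ∈ S → size 1F ≡ n ∸ 2
      size₁≡n∸2 0∈S 2∈S = begin
        size 1F                      ≡⟨ ℕ.m+n∸n≡m (size 1F) 2 ⟨
        size 1F + 2 ∸ 2              ≡⟨ cong (λ c → size 1F + suc c ∸ 2) (size-single 2∈S) ⟨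
        size 1F + suc (size 2F) ∸ 2  ≡⟨ cong (_∸ 2) (size₁+size₂ 0∈S) ⟩
        n ∸ 2                        ∎

  K₁,K,K-iso : ∀ {G} → BlowUp (G withLoopsAt ⊤) ⁅ 0F ⁆ A →
    ∃[ t ] (1 ≤ t × t ≤ n ∸ 2 × Iso A (Lex3 G (K 1) (K t) (K (n ∸ t ∸ 1))))
  K₁,K,K-iso {G} blowUp =
    size 1F , size-positive 1F , t+1+s≡n⇒t≤n∸2 (size-positive 2F) (size₁+size₂ here) ,
    blowUp⇒iso-Lex G _ _ ⊤ loopless (comp3-loopless (K-loopless _) (K-loopless _) (K-loopless _))
      K,K,K-uniform blowUp
      λ { 0F → size-single here ; 1F → refl ; 2F → t+1+s≡n⇒s≡n∸t∸1 (size₁+size₂ here) }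
    where open Sizes blowUp

  K,K,K₁-iso : ∀ {G} → BlowUp (G withLoopsAt ⊤) ⁅ 2F ⁆ A →
    ∃[ t ] (1 ≤ t × t ≤ n ∸ 2 × Iso A (Lex3 G (K t) (K (n ∸ t ∸ 1)) (K 1)))
  K,K,K₁-iso {G} blowUp =
    size 0F , size-positive 0F , t+1+s≡n⇒t≤n∸2 (size-positive 1F) (size₀+size₁ 2∈) ,
    blowUp⇒iso-Lex G _ _ ⊤ loopless (comp3-loopless (K-loopless _) (K-loopless _) (K-loopless _))
      K,K,K-uniform blowUp
      λ { 0F → refl ; 1F → t+1+s≡n⇒s≡n∸t∸1 (size₀+size₁ 2∈) ; 2F → size-single 2∈ }
    where
    open Sizes blowUp

    2∈ : 2F ∈ ⁅ 2F ⁆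
    2∈ = Subset.x∈⁅x⁆ 2F

  K₁,K̄,K₁-iso : ∀ {G} → BlowUp (G withLoopsAt (∁ ⁅ 1F ⁆)) (∁ ⁅ 1F ⁆) A →
    Iso A (Lex3 G (K 1) (Kbar (n ∸ 2)) (K 1))
  K₁,K̄,K₁-iso {G} blowUp =
    blowUp⇒iso-Lex G _ _ (∁ ⁅ 1F ⁆) loopless
      (comp3-loopless (K-loopless _) (λ _ → refl) (K-loopless _))
      K,K̄,K-uniform blowUp
      λ { 0F → size-single here
        ; 1F → size₁≡n∸2 here (there (there here))
        ; 2F → size-single (there (there here)) }
    where open Sizes blowUp

  K₁,P₂,K₁-iso : BlowUp G2-P₂ ⊤ A → Iso A (Lex3 G2 (K 1) P2 (K 1))
  K₁,P₂,K₁-iso blowUp = blowUp-unique loopless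
    (Lex-loopless G2 (size3 1 2 1) _ (comp3-loopless (K-loopless _) P2-loopless (K-loopless _)))
    blowUp K₁,P₂,K₁-blowUp λ _ ∉⊤ → contradiction Subset.∈⊤ ∉⊤

  shape⇒extremal : Shape A → Extremal n A
  shape⇒extremal (G1[K₁,K,K] blowUp) =
    let t , 1≤t , t≤ , iso = K₁,K,K-iso blowUp in inj₂ (inj₁ (t , 1≤t , t≤ , inj₁ iso))
  shape⇒extremal (G2[K₁,K,K] blowUp) =
    let t , 1≤t , t≤ , iso = K₁,K,K-iso blowUp in inj₂ (inj₁ (t , 1≤t , t≤ , inj₂ (inj₁ iso)))
  shape⇒extremal (G2[K,K,K₁] blowUp) =
    let t , 1≤t , t≤ , iso = K,K,K₁-iso blowUp in inj₂ (inj₁ (t , 1≤t , t≤ , inj₂ (inj₂ iso)))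
  shape⇒extremal (G2[K₁,K̄,K₁] blowUp)  = inj₂ (inj₂ (K₁,K̄,K₁-iso blowUp))
  shape⇒extremal (G2[K₁,P₂,K₁] blowUp) = inj₁ (K₁,P₂,K₁-iso blowUp)

shape⇔extremal : {A : Digraph (Fin n)} → 4 ≤ n → Loopless A → Shape A ⇔ Extremal n A
shape⇔extremal 4≤n loopless = mk⇔ (shape⇒extremal loopless) (extremal⇒shape 4≤n)

blowUp⇒twinCondition : {M : Digraph (Fin m)} {S : Subset m} {A : Digraph V} →
  {True (colourTwinTriples? M S)} → {True (colourDiameter≤2? M S)} →
  BlowUp M S A → TwinCondition A
blowUp⇒twinCondition {M = M} {S} {_} {triples} {diam} blowUp =
  blowUp-twinTriples blowUp (toWitness triples) , blowUp-diameter≤2 blowUp (toWitness diam)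

shape⇒twinCondition : {A : Digraph V} → Shape A → TwinCondition A
shape⇒twinCondition (G1[K₁,K,K] blowUp)   = blowUp⇒twinCondition blowUp
shape⇒twinCondition (G2[K₁,K,K] blowUp)   = blowUp⇒twinCondition blowUp
shape⇒twinCondition (G2[K,K,K₁] blowUp)   = blowUp⇒twinCondition blowUp
shape⇒twinCondition (G2[K₁,K̄,K₁] blowUp)  = blowUp⇒twinCondition blowUp
shape⇒twinCondition (G2[K₁,P₂,K₁] blowUp) = blowUp⇒twinCondition blowUp

-- Classification

one-way-arc : {A : Digraph (Fin n)} → ¬ Undirected A → ∃[ a ] ∃[ b ] OneWayArc A a b
one-way-arc {A = A} ¬undirected with any? (λ a → any? λ b → arcType A a b ≟ᵃ (true , false))
... | yes arc = arc
... | no none = contradiction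
  (λ x y x→y → Bool.¬-not λ y↛x → none (x , y , cong₂ _,_ x→y y↛x)) ¬undirected

OutFan : Digraph V → Set
OutFan A = ∃[ w ] ∃[ x ] ∃[ y ] (x ≢ y × OneWayArc A w x × OneWayArc A w y)

outFan? : (A : Digraph (Fin n)) → Dec (OutFan A)
outFan? A = any? λ w → any? λ x → any? λ y →
  ¬? (x ≟ y) ×-dec (arcType A w x ≟ᵃ _) ×-dec (arcType A w y ≟ᵃ _)

¬outFan⇒unique : {A : Digraph (Fin n)} → ¬ OutFan A →
  ∀ {w x y} → OneWayArc A w x → OneWayArc A w y → x ≡ y
¬outFan⇒unique ¬outFan {w} {x} {y} w-x w-y =
  decidable-stable (x ≟ y) λ x≢y → ¬outFan (w , x , y , x≢y , w-x , w-y)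

hub : Bool → Digraph (Fin 3)
hub b 1F 0F = false
hub b 0F 2F = b
hub b _  _  = true

module _ {A : Digraph (Fin n)} (loopless : Loopless A) (twinCondition : TwinCondition A) where

  private
    triples : TwinTriples (arcType A)
    triples = proj₁ twinCondition

    diam : Diameter≤2 A
    diam = proj₂ twinCondition

    τ : Fin n → Fin n → Bool × Bool
    τ = arcType A

    _⟶_ _↛_ : Fin n → Fin n → Set
    x ⟶ y = A x y ≡ true
    x ↛ y = A x y ≡ false

    ⟶⇒≢ : ∀ {x y} → x ⟶ y → x ≢ y
    ⟶⇒≢ = arc⇒≢ {A = A} loopless

    two-types : ∀ {w x y r s} → w ≢ x → w ≢ y → τ w x ≡ r → τ w y ≡ s → r ≢ s →
      ∀ z → w ≢ z → τ w z ≡ r ⊎ τ w z ≡ s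
    two-types = at-most-two-values triples _≟ᵃ_

    twins-by : ∀ {w x y z r s t} → w ≢ x → w ≢ y → w ≢ z →
      τ w x ≡ r → τ w y ≡ s → τ w z ≡ t → r ≢ t → s ≢ t → TwinsUpTo τ z x y
    twins-by = odd-one-out⇒twins triples _≟_

  module Fan {w x₁ x₂ : Fin n} (x₁≢x₂ : x₁ ≢ x₂)
             (w-x₁ : OneWayArc A w x₁) (w-x₂ : OneWayArc A w x₂) where

    Out : Fin n → Set
    Out = OneWayArc A w

    ∃-in-neighbour : ∃[ y ] (y ⟶ w)
    ∃-in-neighbour with detour diam (≢-sym (⟶⇒≢ (cong proj₁ w-x₁))) (cong proj₂ w-x₁)
    ... | y , _ , y→w = y , y→w

    y₀ : Fin n
    y₀ = proj₁ ∃-in-neighbour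

    In : Fin n → Set
    In v = τ w v ≡ (A w y₀ , true)

    y₀-in : In y₀
    y₀-in = cong (A w y₀ ,_) (proj₂ ∃-in-neighbour)

    out-≢ : ∀ {x} → Out x → w ≢ x
    out-≢ x-out = ⟶⇒≢ (cong proj₁ x-out)

    in-≢ : ∀ {y} → In y → w ≢ y
    in-≢ y-in = ≢-sym (⟶⇒≢ (cong proj₂ y-in))

    out≢in : ∀ {x y} → Out x → In y → x ≢ y
    out≢in x-out y-in refl with trans (sym x-out) y-in
    ... | ()

    out-or-in : ∀ v → w ≢ v → Out v ⊎ In v
    out-or-in = two-types (out-≢ w-x₁) (in-≢ y₀-in) w-x₁ y₀-in λ ()

    out-twins : ∀ {x x′ y} → Out x → Out x′ → In y → TwinsUpTo τ y x x′
    out-twins x-out x′-out y-in =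
      twins-by (out-≢ x-out) (out-≢ x′-out) (in-≢ y-in) x-out x′-out y-in (λ ()) λ ()

    in-twins : ∀ {y y′ x} → In y → In y′ → Out x → TwinsUpTo τ x y y′
    in-twins y-in y′-in x-out =
      twins-by (in-≢ y-in) (in-≢ y′-in) (out-≢ x-out) y-in y′-in x-out (λ ()) λ ()

    other-out : ∀ x → ∃[ x′ ] (Out x′ × x ≢ x′)
    other-out x with x ≟ x₁
    ... | yes refl = x₂ , w-x₂ , x₁≢x₂
    ... | no x≢x₁  = x₁ , w-x₁ , x≢x₁

    after-out : ∀ {x m} → Out x → x ⟶ m → Out m ⊎ In m
    after-out x-out x→m = out-or-in _ λ { refl → Bool.not-¬ x→m (cong proj₂ x-out) }

    out⟶in : ∀ {x y} → Out x → In y → x ⟶ y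
    out⟶in {x} {y} x-out y-in
      with other-out x | detour diam (≢-sym (out-≢ x-out)) (cong proj₂ x-out)
    ... | x′ , x′-out , x≢x′ | m , x→m , m→w with after-out x-out x→m
    ... | inj₁ m-out = contradiction (cong proj₂ m-out) (Bool.not-¬ m→w)
    ... | inj₂ m-in  = trans
      (cong proj₁ (in-twins y-in m-in x′-out x (out≢in x-out y-in) (out≢in x-out m-in) x≢x′)) x→m

    out-or-in⟶out : ∀ {x x′ y} → Out x → Out x′ → In y → x ≢ x′ → x′ ⟶ x ⊎ y ⟶ x
    out-or-in⟶out {x} {x′} {y} x-out x′-out y-in x≢x′ with A x′ x in x′x
    ... | true  = inj₁ refl
    ... | false with detour diam (≢-sym x≢x′) x′x
    ... | m , x′→m , m→x with after-out x′-out x′→m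
    ... | inj₁ m-out = contradiction x′x (Bool.not-¬ (trans (cong proj₁
      (out-twins x-out m-out y-in x′ (≢-sym x≢x′) (⟶⇒≢ x′→m) (out≢in x′-out y-in))) x′→m))
    ... | inj₂ m-in = inj₂ (trans
      (cong proj₂ (in-twins y-in m-in x′-out x (out≢in x-out y-in) (out≢in x-out m-in) x≢x′)) m→x)

    in↛out⇒one-way : ∀ {x x′ y} → Out x → Out x′ → In y → x ≢ x′ → y ↛ x → τ x x′ ≡ (false , true)
    in↛out⇒one-way {x} {x′} x-out x′-out y-in x≢x′ y↛x
      with out-or-in⟶out x-out x′-out y-in x≢x′
         | two-types (out≢in x-out y-in) (≢-sym (out-≢ x-out))
             (cong₂ _,_ (out⟶in x-out y-in) y↛x) (cong swap x-out) (λ ()) x′ x≢x′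
    ... | inj₂ y→x  | _         = contradiction y↛x (Bool.not-¬ y→x)
    ... | inj₁ x′→x | inj₁ x-x′ = contradiction (cong proj₂ x-x′) (Bool.not-¬ x′→x)
    ... | inj₁ _    | inj₂ x-x′ = x-x′

    -- If y ↛ x, then another out-neighbour x′ sees y, w and x in three different types.
    in⟶out : ∀ {x y} → Out x → In y → y ⟶ x
    in⟶out {x} {y} x-out y-in = Bool.¬-not λ y↛x → impossible y↛x (other-out x)
      where
      impossible : y ↛ x → ¬ (∃[ x′ ] (Out x′ × x ≢ x′))
      impossible y↛x (x′ , x′-out , x≢x′)
        with in↛out⇒one-way x-out x′-out y-in x≢x′ y↛x
           | out-or-in⟶out x′-out x-out y-in (≢-sym x≢x′)
      ... | x-x′ | inj₁ x→x′ = Bool.not-¬ x→x′ (cong proj₁ x-x′)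
      ... | x-x′ | inj₂ y→x′ = no-three-values triples
        (out≢in x′-out y-in) (≢-sym (out-≢ x′-out)) (≢-sym x≢x′)
        (cong₂ _,_ (out⟶in x′-out y-in) y→x′) (cong swap x′-out) (cong swap x-x′) (λ ()) (λ ()) λ ()

    out-complete : ∀ {x x′} → Out x → Out x′ → x ≢ x′ → x ⟶ x′
    out-complete {x} {x′} x-out x′-out x≢x′
      with two-types {x′} {y₀} {w} (out≢in x′-out y₀-in) (≢-sym (out-≢ x′-out))
             (cong₂ _,_ (out⟶in x′-out y₀-in) (in⟶out x′-out y₀-in)) (cong swap x′-out) (λ ())
             x (≢-sym x≢x′)
    ... | inj₁ x′-x = cong proj₂ x′-x
    ... | inj₂ x′-x = cong proj₂ x′-x

    -- If y ↛ y′, then y tells y′ apart from w and x₁, so w and x₁ look the same to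
    -- x₂, although x₂ → x₁ and x₂ ↛ w.
    in-complete : ∀ {y y′} → In y → In y′ → y ≢ y′ → y ⟶ y′
    in-complete {y} {y′} y-in y′-in y≢y′ = Bool.¬-not λ y↛y′ → Bool.not-¬
      (trans (cong proj₁ (w~x₁ y↛y′ x₂ (≢-sym (out-≢ w-x₂)) (≢-sym x₁≢x₂) (out≢in w-x₂ y′-in)))
        (out-complete w-x₂ w-x₁ (≢-sym x₁≢x₂)))
      (cong proj₂ w-x₂)
      where
      w~x₁ : y ↛ y′ → TwinsUpTo τ y′ w x₁
      w~x₁ y↛y′ = twins-by (≢-sym (in-≢ y-in)) (≢-sym (out≢in w-x₁ y-in)) y≢y′
        (cong swap y-in) (cong₂ _,_ (in⟶out w-x₁ y-in) (out⟶in w-x₁ y-in)) (cong (_, A y′ y) y↛y′)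
        (λ ()) λ ()

    data _HasColour_ : Fin n → Fin 3 → Set where
      hub-vertex : w HasColour 0F
      out-vertex : ∀ {x} → Out x → x HasColour 1F
      in-vertex  : ∀ {y} → In y → y HasColour 2F

    colour-functional : ∀ {v i j} → v HasColour i → v HasColour j → i ≡ j
    colour-functional hub-vertex         hub-vertex         = refl
    colour-functional hub-vertex         (out-vertex w-out) = contradiction refl (out-≢ w-out)
    colour-functional hub-vertex         (in-vertex w-in)   = contradiction refl (in-≢ w-in)
    colour-functional (out-vertex w-out) hub-vertex         = contradiction refl (out-≢ w-out)
    colour-functional (out-vertex _)     (out-vertex _)     = refl
    colour-functional (out-vertex v-out) (in-vertex v-in)   = contradiction refl (out≢in v-out v-in)
    colour-functional (in-vertex w-in)   hub-vertex         = contradiction refl (in-≢ w-in)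
    colour-functional (in-vertex v-in)   (out-vertex v-out) = contradiction refl (out≢in v-out v-in)
    colour-functional (in-vertex _)      (in-vertex _)      = refl

    fan-blowUp : BlowUp (hub (A w y₀)) ⁅ 0F ⁆ A
    fan-blowUp = blowUp-from-relation _HasColour_ total onto colour-functional single arcs
      where
      total : ∀ v → ∃[ i ] v HasColour i
      total v with w ≟ v
      ... | yes refl = 0F , hub-vertex
      ... | no w≢v with out-or-in v w≢v
      ... | inj₁ v-out = 1F , out-vertex v-out
      ... | inj₂ v-in  = 2F , in-vertex v-in

      onto : ∀ i → ∃[ v ] v HasColour i
      onto 0F = w , hub-vertex
      onto 1F = x₁ , out-vertex w-x₁
      onto 2F = y₀ , in-vertex y₀-in

      single : ∀ {u v i} → i ∈ ⁅ 0F ⁆ → u HasColour i → v HasColour i → u ≡ v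
      single here                       hub-vertex hub-vertex = refl
      single (there (there (there ()))) _          _

      arcs : ∀ {u v i j} → u ≢ v → u HasColour i → v HasColour j → A u v ≡ hub (A w y₀) i j
      arcs u≢v hub-vertex         hub-vertex         = contradiction refl u≢v
      arcs u≢v hub-vertex         (out-vertex v-out) = cong proj₁ v-out
      arcs u≢v hub-vertex         (in-vertex v-in)   = cong proj₁ v-in
      arcs u≢v (out-vertex u-out) hub-vertex         = cong proj₂ u-out
      arcs u≢v (out-vertex u-out) (out-vertex v-out) = out-complete u-out v-out u≢v
      arcs u≢v (out-vertex u-out) (in-vertex v-in)   = out⟶in u-out v-in
      arcs u≢v (in-vertex u-in)   hub-vertex         = cong proj₂ u-in
      arcs u≢v (in-vertex u-in)   (out-vertex v-out) = in⟶out v-out u-in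
      arcs u≢v (in-vertex u-in)   (in-vertex v-in)   = in-complete u-in v-in u≢v

  -- The remaining vertices v all have τ a v = (A a p , true) for a detour b → p → a, as a has no
  -- second out-only neighbour; and A a p is true as a does not have two in-only neighbours.
  tail-joined : 3 < n → ¬ OutFan A → ¬ OutFan (flip A) → ∀ {a b} → OneWayArc A a b →
    ∀ {v} → v ≢ a → v ≢ b → τ a v ≡ (true , true)
  tail-joined 3<n ¬outFan ¬inFan {a} {b} a-b v≢a v≢b = trans (like-p v≢a v≢b) (cong (_, true) a→p)
    where
    a≢b : a ≢ b
    a≢b = ⟶⇒≢ (cong proj₁ a-b)

    b-to-a : ∃[ p ] (b ⟶ p × p ⟶ a)
    b-to-a = detour diam (≢-sym a≢b) (cong proj₂ a-b)

    p : Fin n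
    p = proj₁ b-to-a

    p→a : p ⟶ a
    p→a = proj₂ (proj₂ b-to-a)

    like-p : ∀ {v} → v ≢ a → v ≢ b → τ a v ≡ (A a p , true)
    like-p {v} v≢a v≢b
      with two-types a≢b (≢-sym (⟶⇒≢ p→a)) a-b (cong (A a p ,_) p→a) (λ ()) v (≢-sym v≢a)
    ... | inj₁ a-v = contradiction (¬outFan⇒unique {A = A} ¬outFan a-v a-b) v≢b
    ... | inj₂ a-v = a-v

    a→p : a ⟶ p
    a→p with fourth-vertex 3<n a b p
    ... | q , q≢a , q≢b , q≢p = Bool.¬-not λ a↛p → q≢p (¬outFan⇒unique {A = flip A} ¬inFan
      (trans (cong swap (like-p q≢a q≢b)) (cong (true ,_) a↛p)) (cong₂ _,_ p→a a↛p))

  module OneWay {a b : Fin n} (a-b : OneWayArc A a b)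
    (a-joined : ∀ {v} → v ≢ a → v ≢ b → τ a v ≡ (true , true))
    (b-joined : ∀ {v} → v ≢ a → v ≢ b → τ b v ≡ (true , true)) where

    a≢b : a ≢ b
    a≢b = ⟶⇒≢ (cong proj₁ a-b)

    Middle : Fin n → Set
    Middle v = v ≢ a × v ≢ b

    middle-twins : ∀ {x y} → Middle x → Middle y → TwinsUpTo τ b x y
    middle-twins (x≢a , x≢b) (y≢a , y≢b) = twins-by (≢-sym x≢a) (≢-sym y≢a) a≢b
      (a-joined x≢a x≢b) (a-joined y≢a y≢b) a-b (λ ()) λ ()

    same-out : ∀ {u x y} → Middle u → Middle x → Middle y → u ≢ x → u ≢ y → A u x ≡ A u y
    same-out (_ , u≢b) x-mid y-mid u≢x u≢y = cong proj₁ (middle-twins x-mid y-mid _ u≢x u≢y u≢b)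

    same-in : ∀ {x y u} → Middle x → Middle y → Middle u → x ≢ u → y ≢ u → A x u ≡ A y u
    same-in x-mid y-mid (_ , u≢b) x≢u y≢u =
      cong proj₂ (middle-twins x-mid y-mid _ (≢-sym x≢u) (≢-sym y≢u) u≢b)

    third⇒symmetric : ∀ {x y z} → Middle x → Middle y → Middle z →
      x ≢ y → x ≢ z → y ≢ z → A x y ≡ A y x
    third⇒symmetric {x} {y} {z} x-mid y-mid z-mid x≢y x≢z y≢z = begin
      A x y ≡⟨ same-out x-mid y-mid z-mid x≢y x≢z ⟩
      A x z ≡⟨ same-in x-mid y-mid z-mid x≢z y≢z ⟩
      A y z ≡⟨ same-out y-mid z-mid x-mid y≢z (≢-sym x≢y) ⟩
      A y x ∎
      where open ≡-Reasoning

    MiddleSymmetric : Set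
    MiddleSymmetric = ∀ {x y} → Middle x → Middle y → A x y ≡ A y x

    module _ (symmetric : MiddleSymmetric) where

      symmetric⇒uniform : ∀ {x y u v} → Middle x → Middle y → Middle u → Middle v →
        x ≢ y → u ≢ v → A x y ≡ A u v
      symmetric⇒uniform {x} {y} {u} {v} x-mid y-mid u-mid v-mid x≢y u≢v with x ≟ v
      ... | no x≢v   =
        trans (same-out x-mid y-mid v-mid x≢y x≢v) (same-in x-mid u-mid v-mid x≢v u≢v)
      ... | yes refl = trans (symmetric x-mid y-mid) (same-in y-mid u-mid x-mid (≢-sym x≢y) u≢v)

      data _HasColour_ : Fin n → Fin 3 → Set where
        head   : b HasColour 0F
        middle : ∀ {v} → Middle v → v HasColour 1F
        tail   : a HasColour 2F

      colour-functional : ∀ {v i j} → v HasColour i → v HasColour j → i ≡ j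
      colour-functional head               head               = refl
      colour-functional head               (middle (_ , b≢b)) = contradiction refl b≢b
      colour-functional head               tail               = contradiction refl a≢b
      colour-functional (middle (_ , b≢b)) head               = contradiction refl b≢b
      colour-functional (middle _)         (middle _)         = refl
      colour-functional (middle (a≢a , _)) tail               = contradiction refl a≢a
      colour-functional tail               head               = contradiction refl a≢b
      colour-functional tail               (middle (a≢a , _)) = contradiction refl a≢a
      colour-functional tail               tail               = refl

      uniform-blowUp : ∀ D {S p q} → Middle p → Middle q → p ≢ q → A p q ≡ lookup D 1F → 1F ∉ S →
        BlowUp (G2 withLoopsAt D) S A
      uniform-blowUp D {S} {p} {q} p-mid q-mid p≢q pq≡D 1∉S =
        blowUp-from-relation _HasColour_ total onto colour-functional single arcs
        where
        total : ∀ v → ∃[ i ] v HasColour i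
        total v with v ≟ a | v ≟ b
        ... | yes refl | _        = 2F , tail
        ... | no _     | yes refl = 0F , head
        ... | no v≢a   | no v≢b   = 1F , middle (v≢a , v≢b)

        onto : ∀ i → ∃[ v ] v HasColour i
        onto 0F = b , head
        onto 1F = p , middle p-mid
        onto 2F = a , tail

        single : ∀ {u v i} → i ∈ S → u HasColour i → v HasColour i → u ≡ v
        single _   head       head = refl
        single 1∈S (middle _) _    = contradiction 1∈S 1∉S
        single _   tail       tail = refl

        arcs : ∀ {u v i j} → u ≢ v → u HasColour i → v HasColour j → A u v ≡ (G2 withLoopsAt D) i j
        arcs u≢v head                 head                 = contradiction refl u≢v
        arcs u≢v head                 (middle (v≢a , v≢b)) = cong proj₁ (b-joined v≢a v≢b)
        arcs u≢v head                 tail                 = cong proj₂ a-b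
        arcs u≢v (middle (u≢a , u≢b)) head                 = cong proj₂ (b-joined u≢a u≢b)
        arcs u≢v (middle u-mid)       (middle v-mid)       =
          trans (symmetric⇒uniform u-mid v-mid p-mid q-mid u≢v p≢q) pq≡D
        arcs u≢v (middle (u≢a , u≢b)) tail                 = cong proj₂ (a-joined u≢a u≢b)
        arcs u≢v tail                 head                 = cong proj₁ a-b
        arcs u≢v tail                 (middle (v≢a , v≢b)) = cong proj₁ (a-joined v≢a v≢b)
        arcs u≢v tail                 tail                 = contradiction refl u≢v

    path-blowUp : ∀ {r s} → Middle r → Middle s → OneWayArc A r s → BlowUp G2-P₂ ⊤ A
    path-blowUp {r} {s} r-mid@(r≢a , r≢b) s-mid@(s≢a , s≢b) r-s =
      blowUp-from-vertices (from-yes (distinctRows? G2-P₂)) vertex covers vertex-arcs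
      where
      vertex : Fin 4 → Fin n
      vertex 0F = b
      vertex 1F = r
      vertex 2F = s
      vertex 3F = a

      covers : ∀ x → ∃[ i ] vertex i ≡ x
      covers x with x ≟ a | x ≟ b | x ≟ r | x ≟ s
      ... | yes refl | _        | _        | _        = 3F , refl
      ... | no _     | yes refl | _        | _        = 0F , refl
      ... | no _     | no _     | yes refl | _        = 1F , refl
      ... | no _     | no _     | no _     | yes refl = 2F , refl
      ... | no x≢a   | no x≢b   | no x≢r   | no x≢s   = contradiction
        (trans (sym (cong proj₁ r-s)) (trans (third⇒symmetric r-mid s-mid (x≢a , x≢b)
          (⟶⇒≢ (cong proj₁ r-s)) (≢-sym x≢r) (≢-sym x≢s)) (cong proj₂ r-s))) λ ()

      vertex-arcs : ∀ i j → A (vertex i) (vertex j) ≡ G2-P₂ i j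
      vertex-arcs 0F 0F = loopless b
      vertex-arcs 0F 1F = cong proj₁ (b-joined r≢a r≢b)
      vertex-arcs 0F 2F = cong proj₁ (b-joined s≢a s≢b)
      vertex-arcs 0F 3F = cong proj₂ a-b
      vertex-arcs 1F 0F = cong proj₂ (b-joined r≢a r≢b)
      vertex-arcs 1F 1F = loopless r
      vertex-arcs 1F 2F = cong proj₁ r-s
      vertex-arcs 1F 3F = cong proj₂ (a-joined r≢a r≢b)
      vertex-arcs 2F 0F = cong proj₂ (b-joined s≢a s≢b)
      vertex-arcs 2F 1F = cong proj₂ r-s
      vertex-arcs 2F 2F = loopless s
      vertex-arcs 2F 3F = cong proj₂ (a-joined s≢a s≢b)
      vertex-arcs 3F 0F = cong proj₁ a-b
      vertex-arcs 3F 1F = cong proj₁ (a-joined r≢a r≢b)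
      vertex-arcs 3F 2F = cong proj₁ (a-joined s≢a s≢b)
      vertex-arcs 3F 3F = loopless a

    symmetric⇒shape : 3 < n → MiddleSymmetric → Shape A
    symmetric⇒shape 3<n symmetric with fourth-vertex 3<n a b b
    ... | p , p≢a , p≢b , _ with fourth-vertex 3<n a b p
    ... | q , q≢a , q≢b , q≢p with A p q in pq
    ... | true  = G2[K₁,K,K] (uniform-blowUp symmetric ⊤
                    (p≢a , p≢b) (q≢a , q≢b) (≢-sym q≢p) pq λ { (there ()) })
    ... | false = G2[K₁,K̄,K₁] (uniform-blowUp symmetric (∁ ⁅ 1F ⁆)
                    (p≢a , p≢b) (q≢a , q≢b) (≢-sym q≢p) pq λ { (there ()) })

    OneWayMiddle : Set
    OneWayMiddle = ∃[ r ] ∃[ s ] (Middle r × Middle s × OneWayArc A r s)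

    oneWayMiddle? : Dec OneWayMiddle
    oneWayMiddle? = any? λ r → any? λ s →
      middle? r ×-dec middle? s ×-dec (τ r s ≟ᵃ (true , false))
      where
      middle? : ∀ v → Dec (Middle v)
      middle? v = ¬? (v ≟ a) ×-dec ¬? (v ≟ b)

    ¬oneWay⇒symmetric : ¬ OneWayMiddle → MiddleSymmetric
    ¬oneWay⇒symmetric ¬oneWay {x} {y} x-mid y-mid with A x y in xy | A y x in yx
    ... | true  | true  = refl
    ... | false | false = refl
    ... | true  | false = contradiction (x , y , x-mid , y-mid , cong₂ _,_ xy yx) ¬oneWay
    ... | false | true  = contradiction (y , x , y-mid , x-mid , cong₂ _,_ yx xy) ¬oneWay

    oneWay-shape : 3 < n → Shape A
    oneWay-shape 3<n with oneWayMiddle?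
    ... | yes (_ , _ , r-mid , s-mid , r-s) = G2[K₁,P₂,K₁] (path-blowUp r-mid s-mid r-s)
    ... | no ¬oneWay                        = symmetric⇒shape 3<n (¬oneWay⇒symmetric ¬oneWay)

isIso? : (M M′ : Digraph (Fin m)) (π : Permutation m m) →
  Dec (∀ i j → M i j ≡ M′ (π ⟨$⟩ʳ i) (π ⟨$⟩ʳ j))
isIso? M M′ π = all? λ i → all? λ j → M i j Bool.≟ M′ (π ⟨$⟩ʳ i) (π ⟨$⟩ʳ j)

hub⇒shape : {A : Digraph V} (b : Bool) → BlowUp (hub b) ⁅ 0F ⁆ A → Shape A
hub⇒shape false blowUp = G1[K₁,K,K] (blowUp-recolour
  (id , from-yes (isIso? (hub false) (G1 withLoopsAt ⊤) id)) (λ _ 0∈ → 0∈) blowUp)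
hub⇒shape true blowUp = G2[K,K,K₁] (blowUp-recolour
  (rotation , from-yes (isIso? (hub true) (G2 withLoopsAt ⊤) rotation))
  (from-yes (all? λ i → ((rotation ⟨$⟩ʳ i) Subset.∈? ⁅ 2F ⁆) →-dec (i Subset.∈? ⁅ 0F ⁆))) blowUp)
  where
  rotation : Permutation 3 3
  rotation = transpose 0F 2F ∘ₚ transpose 0F 1F

reverse-hub⇒shape : {A : Digraph V} (b : Bool) → BlowUp (flip (hub b)) ⁅ 0F ⁆ A → Shape A
reverse-hub⇒shape {A = A} = shape
  where
  reflection : Permutation 3 3
  reflection = transpose 1F 2F

  fixes-0F : ∀ i → reflection ⟨$⟩ʳ i ∈ ⁅ 0F ⁆ → i ∈ ⁅ 0F ⁆
  fixes-0F = from-yes (all? λ i → ((reflection ⟨$⟩ʳ i) Subset.∈? ⁅ 0F ⁆) →-dec (i Subset.∈? ⁅ 0F ⁆))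

  shape : ∀ b → BlowUp (flip (hub b)) ⁅ 0F ⁆ A → Shape A
  shape false = G1[K₁,K,K] ∘ blowUp-recolour
    (reflection , from-yes (isIso? (flip (hub false)) (G1 withLoopsAt ⊤) reflection)) fixes-0F
  shape true = G2[K₁,K,K] ∘ blowUp-recolour
    (reflection , from-yes (isIso? (flip (hub true)) (G2 withLoopsAt ⊤) reflection)) fixes-0F

module _ {A : Digraph (Fin n)} (loopless : Loopless A) (twinCondition : TwinCondition A) where

  outFan⇒shape : OutFan A → Shape A
  outFan⇒shape (_ , _ , _ , x≢y , w-x , w-y) =
    hub⇒shape _ (Fan.fan-blowUp loopless twinCondition x≢y w-x w-y)

  inFan⇒shape : OutFan (flip A) → Shape A
  inFan⇒shape (_ , _ , _ , x≢y , w-x , w-y) = reverse-hub⇒shape _ (blowUp-flip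
    (Fan.fan-blowUp {A = flip A} loopless (twinCondition-flip twinCondition) x≢y w-x w-y))

  noFan⇒shape : 3 < n → ¬ OutFan A → ¬ OutFan (flip A) → ∀ {a b} → OneWayArc A a b → Shape A
  noFan⇒shape 3<n ¬outFan ¬inFan a-b = OneWay.oneWay-shape loopless twinCondition a-b
    (tail-joined loopless twinCondition 3<n ¬outFan ¬inFan a-b)
    (λ v≢a v≢b → cong swap (tail-joined {A = flip A} loopless (twinCondition-flip twinCondition)
      3<n ¬inFan ¬outFan a-b v≢b v≢a))
    3<n

  twinCondition⇒shape : 3 < n → ∀ {a b} → OneWayArc A a b → Shape A
  twinCondition⇒shape 3<n a-b with outFan? A | outFan? (flip A)
  ... | yes outFan | _         = outFan⇒shape outFan
  ... | no _       | yes inFan = inFan⇒shape inFan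
  ... | no ¬outFan | no ¬inFan = noFan⇒shape 3<n ¬outFan ¬inFan a-b

twinCondition⇔shape : {A : Digraph (Fin n)} → 3 < n → Loopless A →
  ∀ {a b} → OneWayArc A a b → TwinCondition A ⇔ Shape A
twinCondition⇔shape 3<n loopless a-b =
  mk⇔ (λ twinCondition → twinCondition⇒shape loopless twinCondition 3<n a-b) shape⇒twinCondition

theorem4p2 : (n : ℕ) (A : Digraph (Fin n)) → 4 ≤ n → Loopless A → StronglyConnected A
    → ¬ Undirected A → (HasDim A (n ∸ 2) ⇔ Extremal n A)
theorem4p2 n A 4≤n loopless connected ¬undirected with one-way-arc ¬undirected
... | a , b , a-b =
  HasDim A (n ∸ 2)           ∼⟨ dim≡n∸2⇔twinTriples connected loopless a-b ⟩
  TwinTriples (∂̃ connected)  ∼⟨ twinTriples⇔twinCondition connected ⟩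
  TwinCondition A            ∼⟨ twinCondition⇔shape 4≤n loopless a-b ⟩
  Shape A                    ∼⟨ shape⇔extremal 4≤n loopless ⟩
  Extremal n A               ∎
  where open EquationalReasoning
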